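{- Let $\mu$ be a partition, and let $$C_\mu(x;q,t)=\sum_{\sigma\colon\mu\to\mathbb Z_+} q^{\operatorname{inv}(\sigma)}\,t^{\operatorname{maj}(\sigma)}\,x^\sigma ,$$ the sum being over all fillings $\sigma$ of the diagram of $\mu$ by positive integers. Then $C_\mu(x;q,t)$ is symmetric in the variables $x=x_1,x_2,\dots$.
   Context: $\mathbb Z_+=\{1,2,\dots\}$. For a partition $\mu=(\mu_1\ge\dots\ge\mu_l)$, its diagram is $\{(i,j)\in\mathbb Z_+\times\mathbb Z_+: j\le\mu_i\}$, identified with $\mu$; $(i,j)$ is the cell in row $i$, column $j$, and rows are numbered from bottom to top (French convention), so $(i+1,j)$ is directly above $(i,j)$ and row 1 is the bottom row. A filling is a function $\sigma\colon\mu\to\mathbb Z_+$, and $x^\sigma=\prod_{u\in\mu}x_{\sigma(u)}$, a monomial in infinitely many variables $x_1,x_2,\dots$. $\operatorname{Des}(\sigma)$ is the set of cells $u=(i+1,j)\in\mu$ such that $\sigma(u)>\sigma(v)$, where $v=(i,j)$. Two cells attack each other if either they are two distinct cells in the same row, or they have the form $(i+1,k)$ and $(i,j)$ with $j<k$. The reading order is the total order on cells row by row, from top to bottom, left to right within each row. $\operatorname{Inv}(\sigma)$ is the set of pairs $\{u,v\}$ of attacking cells with $u$ preceding $v$ in reading order and $\sigma(u)>\sigma(v)$. $\operatorname{arm}(u)$ is the number of cells of $\mu$ strictly to the right of $u$ in its row; $\operatorname{leg}(u)$ is the number of cells strictly above $u$ in its column. Define $$\operatorname{maj}(\sigma)=\sum_{u\in\operatorname{Des}(\sigma)}(\operatorname{leg}(u)+1),\qquad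 \operatorname{inv}(\sigma)=|\operatorname{Inv}(\sigma)|-\sum_{u\in\operatorname{Des}(\sigma)}\operatorname{arm}(u).$$ -}

module Defs where

open import Data.Fin.Base using (Fin; zero; suc; toℕ)
open import Data.Fin.Properties using (any?) renaming (_≟_ to _≟ᶠ_)
open import Data.Integer.Base as ℤ using (ℤ; +_)
import Data.Integer.Properties as ℤ
open import Data.List.Base
  using (List; []; _∷_; length; lookup; map; filter; foldr;
         concatMap; cartesianProduct; cartesianProductWith; allFin; upTo)
open import Data.List.Relation.Unary.All using (All)
open import Data.List.Relation.Unary.Linked using (Linked)
open import Data.Nat.Base
open import Data.Nat.ListAction using (sum)
open import Data.Nat.Properties
open import Data.Product.Base using (Σ; ∃; _×_; _,_; proj₁; proj₂; uncurry)
open import Data.Product.Properties using (≡-dec)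
open import Data.Sum.Base using (_⊎_)
open import Function.Base using (_∘_)
open import Function.Bundles using (_⤖_; module Bijection)
open import Relation.Nullary.Decidable.Core
  using (Dec; yes; no; map′; _×-dec_; _⊎-dec_; ¬?)
open import Relation.Nullary.Negation.Core using (contradiction)
open import Relation.Binary.Definitions using (DecidableEquality)
open import Relation.Binary.PropositionalEquality.Core
  using (_≡_; _≢_; refl; sym; trans; cong₂)

-- The positive integers (rows, columns, filling entries and variable indices)
-- are all represented by ℕ, with n standing for n + 1.  Only their order and
-- successor are ever used, so the shift has no effect.

record Partition : Set where
  field
    parts      : List ℕ
    decreasing : Linked _≥_ parts
    positive   : All (_> 0) parts

open Partition public

------------------------------------------------------------------------
-- Monomials in x₀, x₁, x₂, …

record Monomial : Set where
  field
    exponent : ℕ → ℕ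
    bound    : ℕ
    vanishes : ∀ {k} → bound ≤ k → exponent k ≡ 0

open Monomial public

infix 4 _≈_ _≈?_

-- The bound is only a witness of finite support, not part of the monomial.

_≈_ : Monomial → Monomial → Set
α ≈ β = ∀ k → exponent α k ≡ exponent β k

_≈?_ : ∀ α β → Dec (α ≈ β)
α ≈? β = map′ extend (λ eq {k} _ → eq k)
              (allUpTo? (λ k → exponent α k ≟ exponent β k) B)
  where
  B = bound α ⊔ bound β

  extend : (∀ {k} → k < B → exponent α k ≡ exponent β k) → α ≈ β
  extend eq k with k <? B
  ... | yes k<B = eq k<B
  ... | no  k≮B = trans (vanishes α (≤-trans (m≤m⊔n _ _) (≮⇒≥ k≮B)))
                        (sym (vanishes β (≤-trans (m≤n⊔m (bound α) _) (≮⇒≥ k≮B))))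

1ᴹ : Monomial
1ᴹ = record { exponent = λ _ → 0 ; bound = 0 ; vanishes = λ _ → refl }

infixl 7 _·_

_·_ : Monomial → Monomial → Monomial
α · β = record
  { exponent = λ k → exponent α k + exponent β k
  ; bound    = bound α ⊔ bound β
  ; vanishes = λ b≤k → cong₂ _+_ (vanishes α (≤-trans (m≤m⊔n _ _) b≤k))
                                 (vanishes β (≤-trans (m≤n⊔m (bound α) _) b≤k))
  }

indicator : ∀ {P : Set} → Dec P → ℕ
indicator (yes _) = 1
indicator (no  _) = 0

var : ℕ → Monomial
var i = record
  { exponent = λ k → indicator (i ≟ k) ; bound = suc i ; vanishes = vanish }
  where
  vanish : ∀ {k} → i < k → indicator (i ≟ k) ≡ 0
  vanish {k} i<k with i ≟ k
  ... | yes i≡k = contradiction i≡k (<⇒≢ i<k)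
  ... | no  _   = refl

------------------------------------------------------------------------
-- Formal power series in the x's with coefficients polynomial in q^±1 and t

-- p a b is the coefficient of qᵃ tᵇ.  The exponent of q is an integer because
-- inv is defined below as a difference.

Poly : Set
Poly = ℤ → ℕ → ℕ

q^_t^_ : ℤ → ℕ → Poly
(q^ m t^ n) a b = indicator ((m ℤ.≟ a) ×-dec (n ≟ b))

sumᴾ : List Poly → Poly
sumᴾ ps a b = sum (map (λ p → p a b) ps)

-- F α is the coefficient of x^α.

Series : Set
Series = Monomial → Poly

-- Substituting x_{π k} for x_k turns x^α into the x^β with β_{π k} = α_k, so F
-- is invariant under π exactly when the coefficients of all such pairs x^α, x^β
-- agree.

Symmetric : Series → Set
Symmetric F = ∀ (π : ℕ ⤖ ℕ) (α β : Monomial) →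
  (∀ k → exponent β (Bijection.to π k) ≡ exponent α k) →
  ∀ a b → F α a b ≡ F β a b

------------------------------------------------------------------------
-- Enumeration of dependent functions on a finite domain

functions : ∀ {n} {B : Fin n → Set} → (∀ i → List (B i)) → List (∀ i → B i)
functions {zero}          xs = (λ ()) ∷ []
functions {suc n} {B = B} xs =
  cartesianProductWith cons (xs zero) (functions (xs ∘ suc))
  where
  cons : B zero → (∀ i → B (suc i)) → ∀ i → B i
  cons x f zero    = x
  cons x f (suc i) = f i

module _ (μ : Partition) where

  ----------------------------------------------------------------------
  -- The diagram

  Cell : Set
  Cell = Σ (Fin (length (parts μ))) λ i → Fin (lookup (parts μ) i)

  cells : List Cell
  cells = concatMap (λ i → map (i ,_) (allFin _)) (allFin _)

  -- Row 0 is the bottom row.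

  row col : Cell → ℕ
  row = toℕ ∘ proj₁
  col = toℕ ∘ proj₂

  infix 4 _≟ᶜ_

  _≟ᶜ_ : DecidableEquality Cell
  _≟ᶜ_ = ≡-dec _≟ᶠ_ _≟ᶠ_

  anyCell? : {P : Cell → Set} → (∀ u → Dec (P u)) → Dec (∃ P)
  anyCell? P? = map′ (λ (i , j , p) → (i , j) , p) (λ ((i , j) , p) → i , j , p)
                     (any? λ i → any? λ j → P? (i , j))

  DirectlyAbove : Cell → Cell → Set
  DirectlyAbove u v = row u ≡ suc (row v) × col u ≡ col v

  directlyAbove? : ∀ u v → Dec (DirectlyAbove u v)
  directlyAbove? u v = (row u ≟ suc (row v)) ×-dec (col u ≟ col v)

  -- u = (i + 1 , k) and v = (i , j) with j < k.

  UpperRight : Cell → Cell → Set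
  UpperRight u v = row u ≡ suc (row v) × col v < col u

  upperRight? : ∀ u v → Dec (UpperRight u v)
  upperRight? u v = (row u ≟ suc (row v)) ×-dec (col v <? col u)

  Attack : Cell → Cell → Set
  Attack u v = (row u ≡ row v × u ≢ v) ⊎ (UpperRight u v ⊎ UpperRight v u)

  attack? : ∀ u v → Dec (Attack u v)
  attack? u v = ((row u ≟ row v) ×-dec ¬? (u ≟ᶜ v))
                ⊎-dec (upperRight? u v ⊎-dec upperRight? v u)

  -- The strict reading order: top to bottom, left to right within a row.

  Precedes : Cell → Cell → Set
  Precedes u v = row u > row v ⊎ (row u ≡ row v × col u < col v)

  precedes? : ∀ u v → Dec (Precedes u v)
  precedes? u v = (row v <? row u) ⊎-dec ((row u ≟ row v) ×-dec (col u <? col v))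

  arm : Cell → ℕ
  arm u = length (filter (λ v → (row v ≟ row u) ×-dec (col u <? col v)) cells)

  leg : Cell → ℕ
  leg u = length (filter (λ v → (col v ≟ col u) ×-dec (row u <? row v)) cells)

  ----------------------------------------------------------------------
  -- Fillings and their statistics

  Filling : Set
  Filling = Cell → ℕ

  x^_ : Filling → Monomial
  x^ σ = foldr _·_ 1ᴹ (map (var ∘ σ) cells)

  module _ (σ : Filling) where

    IsDescent : Cell → Set
    IsDescent u = ∃ λ v → DirectlyAbove u v × σ u > σ v

    isDescent? : ∀ u → Dec (IsDescent u)
    isDescent? u = anyCell? λ v → directlyAbove? u v ×-dec (σ v <? σ u)

    Des : List Cell
    Des = filter isDescent? cells

    IsInversion : Cell × Cell → Set
    IsInversion (u , v) = Attack u v × Precedes u v × σ u > σ v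

    isInversion? : ∀ p → Dec (IsInversion p)
    isInversion? (u , v) = attack? u v ×-dec (precedes? u v ×-dec (σ v <? σ u))

    -- An unordered pair {u , v} is listed once, with the cell that comes first
    -- in reading order as first component.

    Inv : List (Cell × Cell)
    Inv = filter isInversion? (cartesianProduct cells cells)

    maj : ℕ
    maj = sum (map (λ u → leg u + 1) Des)

    inv : ℤ
    inv = + length Inv ℤ.- + sum (map arm Des)

  ----------------------------------------------------------------------
  -- The series C_μ

  -- All fillings with entries < N, each listed once (up to pointwise equality).

  fillingsBelow : ℕ → List Filling
  fillingsBelow N = map uncurry (functions λ i → functions λ j → upTo N)

  -- The coefficient of x^α collects q^inv t^maj over all fillings with
  -- x^σ = x^α.  Every entry k of such a filling has α_k ≠ 0, hence k < bound α,
  -- so all of them occur in the finite list used here.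

  C : Series
  C α = sumᴾ (map (λ σ → q^ inv σ t^ maj σ)
                  (filter (λ σ → x^ σ ≈? α) (fillingsBelow (bound α))))

{-# OPTIONS --safe #-}

-- Write inv and maj together as a weight in ℤ × ℕ that is additive over pairs of
-- cells: a pair u, v with u before v in reading order and σ(u) > σ(v) contributes
-- a fixed edge(u, v), which is (1 , 0) if u attacks v and (- arm u , leg u + 1) if
-- u lies directly above v.  If u ≺ v ≺ w in reading order and edge(u, w) ≠ 0, then
-- edge(u, v) = edge(v, w) = (1 , 0); nothing else about the edges matters.
--
-- It suffices to exchange x_a and x_{a+1}.  Fixing the places of the other entries
-- leaves a sum over two-letter words f, whose symmetry is shown by induction on
-- the number of vertices.  Let v be the first vertex.  Summing over f(v), the
-- claim reduces to the symmetry of the sum over the remaining words of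
--   1 - ∏_{f(c) = 0} edge(v, c)
--     = Σ_{f(c) = 0} (1 - edge(v, c)) ∏_{b ≺ c, f(b) = 0} edge(v, b)
-- (weights now written multiplicatively).  If edge(v, c) ≠ 1, every b between v
-- and c has edge(v, b) = edge(b, c) = q, so the zeros b counted here and the ones
-- b that form inversions with c together give the constant q^#{b}: the term of c
-- is a multiple of the sum with v and c deleted, which is symmetric by induction.

module Submission where

open import Defs

open import Algebra.Bundles using (CommutativeMonoid)
import Algebra.Properties.CommutativeSemigroup as CommutativeSemigroupProperties
open import Algebra.Structures using (IsCommutativeMonoid)
open import Data.Bool.Base using (Bool; true; false; if_then_else_)
open import Data.Empty using (⊥; ⊥-elim)
open import Data.Fin.Base using (Fin; zero; suc; toℕ)
import Data.Fin.Properties as Fin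
open import Data.Integer.Base as ℤ using (ℤ) renaming (+_ to ⁺_)
import Data.Integer.Properties as ℤ
open import Data.Integer.Tactic.RingSolver using () renaming (solve-∀ to solve-∀ᶻ)
open import Data.List.Base hiding (sum; merge; drop)
open import Data.List.Membership.Propositional using (_∈_; _∉_)
import Data.List.Membership.Propositional.Properties as ∈
open import Data.List.Properties
  using (map-∘; map-++; map-cong; map-tabulate; tabulate-cong; concat-map;
         map-upTo; upTo-∷ʳ; ++-assoc; ++-identityʳ; length-++-sucʳ)
open import Data.List.Relation.Binary.Permutation.Propositional as ↭
  using (_↭_; prep; swap; ↭⇒↭ₛ; ↭-sym)
import Data.List.Relation.Binary.Permutation.Propositional.Properties as ↭
import Data.List.Relation.Binary.Permutation.Setoid.Properties as ↭ₛ
open import Data.List.Relation.Binary.Pointwise using (Pointwise; []; _∷_)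
open import Data.List.Relation.Unary.All as All using (All; []; _∷_)
import Data.List.Relation.Unary.All.Properties as All
open import Data.List.Relation.Unary.AllPairs as AllPairs using (AllPairs; []; _∷_)
import Data.List.Relation.Unary.AllPairs.Properties as AllPairs
open import Data.List.Relation.Unary.Any using (here; there)
open import Data.List.Relation.Unary.Unique.Propositional using (Unique)
open import Data.List.Relation.Unary.Unique.Propositional.Properties
  using (upTo⁺) renaming (map⁺ to Unique-map⁺)
open import Data.Maybe.Base using (Maybe; just; nothing)
open import Data.Maybe.Relation.Unary.All as Maybe using (just; nothing)
open import Data.Nat.Base
open import Data.Nat.ListAction using (sum)
open import Data.Nat.ListAction.Properties using (sum-++; sum-↭)
open import Data.Nat.Properties
open import Data.Nat.Tactic.RingSolver using (solve-∀)
open import Data.Product.Base using (∃; _×_; _,_; proj₁; proj₂; uncurry)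
open import Data.Sum.Base using (_⊎_; inj₁; inj₂)
open import Function.Base using (_∘_; id)
open import Function.Bundles using (module Bijection)
open import Relation.Binary.PropositionalEquality
open import Relation.Nullary.Decidable using (Dec; yes; no; does; dec-true; dec-false; _×-dec_)

open CommutativeSemigroupProperties +-commutativeSemigroup using ()
  renaming (interchange to +-interchange; x∙yz≈y∙xz to +-swap)
open ≡-Reasoning

private
  variable
    A B V : Set

-- Finite sums and sums over words

∑ : List A → (A → ℕ) → ℕ
∑ xs f = sum (map f xs)

∑-cong : ∀ (xs : List A) {f g : A → ℕ} →
         (∀ {x} → x ∈ xs → f x ≡ g x) → ∑ xs f ≡ ∑ xs g
∑-cong []       eq = refl
∑-cong (x ∷ xs) eq = cong₂ _+_ (eq (here refl)) (∑-cong xs (eq ∘ there))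

∑-+ : ∀ (xs : List A) {f g : A → ℕ} → ∑ xs (λ x → f x + g x) ≡ ∑ xs f + ∑ xs g
∑-+ []       = refl
∑-+ (x ∷ xs) {f} {g} =
  trans (cong (f x + g x +_) (∑-+ xs)) (+-interchange (f x) (g x) _ _)

∑-zero : ∀ (xs : List A) → ∑ xs (λ _ → 0) ≡ 0
∑-zero []       = refl
∑-zero (_ ∷ xs) = ∑-zero xs

∑-comm : ∀ (xs : List A) (ys : List B) {f : A → B → ℕ} →
         ∑ xs (λ x → ∑ ys (f x)) ≡ ∑ ys (λ y → ∑ xs λ x → f x y)
∑-comm []       ys     = sym (∑-zero ys)
∑-comm (x ∷ xs) ys {f} =
  trans (cong (∑ ys (f x) +_) (∑-comm xs ys)) (sym (∑-+ ys))

∑-↭ : ∀ {xs ys : List A} → xs ↭ ys → (f : A → ℕ) → ∑ xs f ≡ ∑ ys f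
∑-↭ xs↭ys f = sum-↭ (↭.map⁺ f xs↭ys)

∑-++ : ∀ (xs ys : List A) (f : A → ℕ) → ∑ (xs ++ ys) f ≡ ∑ xs f + ∑ ys f
∑-++ xs ys f = trans (cong sum (map-++ f xs ys)) (sum-++ (map f xs) (map f ys))

-- Each letter carries its vertex, so that a word can be permuted, cut or merged without a separate
-- record of places.
Word : Set → Set → Set
Word V A = List (V × A)

∑ʷ : List A → List V → (Word V A → ℕ) → ℕ
∑ʷ X []      F = F []
∑ʷ X (v ∷ L) F = ∑ X λ x → ∑ʷ X L λ P → F ((v , x) ∷ P)

Over : List A → List V → Word V A → Set
Over X = Pointwise λ v p → proj₁ p ≡ v × proj₂ p ∈ X

module _ (X : List A) where

  ∑ʷ-cong : ∀ (L : List V) {F G : Word V A → ℕ} →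
            (∀ {P} → Over X L P → F P ≡ G P) → ∑ʷ X L F ≡ ∑ʷ X L G
  ∑ʷ-cong []      eq = eq []
  ∑ʷ-cong (v ∷ L) eq =
    ∑-cong X λ x∈X → ∑ʷ-cong L λ over → eq ((refl , x∈X) ∷ over)

  ∑ʷ-+ : ∀ (L : List V) {F G : Word V A → ℕ} →
         ∑ʷ X L (λ P → F P + G P) ≡ ∑ʷ X L F + ∑ʷ X L G
  ∑ʷ-+ []      = refl
  ∑ʷ-+ (v ∷ L) = trans (∑-cong X λ _ → ∑ʷ-+ L) (∑-+ X)

  ∑ʷ-++ : ∀ (L M : List V) {F : Word V A → ℕ} →
          ∑ʷ X (L ++ M) F ≡ ∑ʷ X L λ P → ∑ʷ X M λ Q → F (P ++ Q)
  ∑ʷ-++ []      M = refl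
  ∑ʷ-++ (v ∷ L) M = ∑-cong X λ _ → ∑ʷ-++ L M

  -- The words of the sum come in the order of the vertex list, so `F` has to ignore the order of
  -- entries. Exchanging two adjacent vertices is then an exchange of the two outer sums.
  ∑ʷ-↭ : ∀ {L M : List V} → L ↭ M → (F : Word V A → ℕ) →
         (∀ {P Q} → P ↭ Q → F P ≡ F Q) → ∑ʷ X L F ≡ ∑ʷ X M F
  ∑ʷ-↭ ↭.refl                 F resp = refl
  ∑ʷ-↭ (prep v L↭M)           F resp =
    ∑-cong X λ {x} _ → ∑ʷ-↭ L↭M (F ∘ ((v , x) ∷_)) (resp ∘ prep _)
  ∑ʷ-↭ {L = _ ∷ _ ∷ L} (swap u v L↭M) F resp = trans (∑-comm X X)
    (∑-cong X λ _ → ∑-cong X λ _ → trans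
      (∑ʷ-cong L λ _ → resp (swap _ _ ↭.refl))
      (∑ʷ-↭ L↭M _ (resp ∘ prep _ ∘ prep _)))
  ∑ʷ-↭ (↭.trans L↭M M↭N)      F resp =
    trans (∑ʷ-↭ L↭M F resp) (∑ʷ-↭ M↭N F resp)

∑ʷ-letters-↭ : ∀ {X Y : List A} → X ↭ Y → (L : List V) {F : Word V A → ℕ} →
               ∑ʷ X L F ≡ ∑ʷ Y L F
∑ʷ-letters-↭ X↭Y []      = refl
∑ʷ-letters-↭ {X = X} X↭Y (v ∷ L) =
  trans (∑-cong X λ _ → ∑ʷ-letters-↭ X↭Y L) (∑-↭ X↭Y _)

-- Cutting two-letter words

∑cut : List V → (List V → V → List V → ℕ) → ℕ
∑cut []      Θ = 0
∑cut (c ∷ L) Θ = Θ [] c L + ∑cut L λ L₁ → Θ (c ∷ L₁)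

∑zero : Word V Bool → (Word V Bool → V → Word V Bool → ℕ) → ℕ
∑zero []                Θ = 0
∑zero ((c , false) ∷ P) Θ = Θ [] c P + ∑zero P λ P₁ → Θ ((c , false) ∷ P₁)
∑zero ((c , true)  ∷ P) Θ = ∑zero P λ P₁ → Θ ((c , true) ∷ P₁)

∑cut-cong : ∀ (L : List V) {Θ Ξ : List V → V → List V → ℕ} →
            (∀ {L₁ c L₂} → L ≡ L₁ ++ c ∷ L₂ → Θ L₁ c L₂ ≡ Ξ L₁ c L₂) →
            ∑cut L Θ ≡ ∑cut L Ξ
∑cut-cong []      eq = refl
∑cut-cong (c ∷ L) eq =
  cong₂ _+_ (eq refl) (∑cut-cong L λ L≡ → eq (cong (c ∷_) L≡))

∑cut-+ : ∀ (L : List V) {Θ Ξ : List V → V → List V → ℕ} →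
         ∑cut L (λ L₁ c L₂ → Θ L₁ c L₂ + Ξ L₁ c L₂) ≡ ∑cut L Θ + ∑cut L Ξ
∑cut-+ []      = refl
∑cut-+ (c ∷ L) {Θ} {Ξ} =
  trans (cong (Θ [] c L + Ξ [] c L +_) (∑cut-+ L))
        (+-interchange (Θ [] c L) (Ξ [] c L) _ _)

∑zero-cong : ∀ (P : Word V Bool) {Θ Ξ : Word V Bool → V → Word V Bool → ℕ} →
             (∀ {P₁ c P₂} → P ≡ P₁ ++ (c , false) ∷ P₂ → Θ P₁ c P₂ ≡ Ξ P₁ c P₂) →
             ∑zero P Θ ≡ ∑zero P Ξ
∑zero-cong []                eq = refl
∑zero-cong ((c , false) ∷ P) eq =
  cong₂ _+_ (eq refl) (∑zero-cong P λ P≡ → eq (cong ((c , false) ∷_) P≡))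
∑zero-cong ((c , true)  ∷ P) eq =
  ∑zero-cong P λ P≡ → eq (cong ((c , true) ∷_) P≡)

bits : List Bool
bits = false ∷ true ∷ []

∑ᵇ : List V → (Word V Bool → ℕ) → ℕ
∑ᵇ = ∑ʷ bits

∑ᵇ-∷ : ∀ (v : V) L (F : Word V Bool → ℕ) →
       ∑ᵇ (v ∷ L) F ≡
       ∑ᵇ L (λ P → F ((v , false) ∷ P)) + ∑ᵇ L (λ P → F ((v , true) ∷ P))
∑ᵇ-∷ v L F = cong (∑ᵇ L (λ P → F ((v , false) ∷ P)) +_) (+-identityʳ _)

-- Double counting: to choose a word and one of its zeros, first choose the vertex `c` of that zero,
-- then the letters on either side of it.
∑ᵇ-∑zero : ∀ (L : List V) {Θ : Word V Bool → V → Word V Bool → ℕ} →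
           ∑ᵇ L (λ P → ∑zero P Θ) ≡
           ∑cut L λ L₁ c L₂ → ∑ᵇ L₁ λ P₁ → ∑ᵇ L₂ λ P₂ → Θ P₁ c P₂
∑ᵇ-∑zero []      = refl
∑ᵇ-∑zero (c ∷ L) {Θ} = begin
  ∑ᵇ (c ∷ L) (λ P → ∑zero P Θ)
    ≡⟨ ∑ᵇ-∷ c L (λ P → ∑zero P Θ) ⟩
  ∑ᵇ L (λ P → Θ [] c P + ∑zero P (Θᶜ false)) + ∑ᵇ L (λ P → ∑zero P (Θᶜ true))
    ≡⟨ cong (_+ ∑ᵇ L (λ P → ∑zero P (Θᶜ true))) (∑ʷ-+ bits L) ⟩
  ∑ᵇ L (Θ [] c) + ∑ᵇ L (λ P → ∑zero P (Θᶜ false)) + ∑ᵇ L (λ P → ∑zero P (Θᶜ true))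
    ≡⟨ +-assoc (∑ᵇ L (Θ [] c)) _ _ ⟩
  ∑ᵇ L (Θ [] c) + (∑ᵇ L (λ P → ∑zero P (Θᶜ false)) + ∑ᵇ L (λ P → ∑zero P (Θᶜ true)))
    ≡⟨ cong (∑ᵇ L (Θ [] c) +_) (cong₂ _+_ (∑ᵇ-∑zero L) (∑ᵇ-∑zero L)) ⟩
  ∑ᵇ L (Θ [] c) + (∑cut L (Ξ false) + ∑cut L (Ξ true))
    ≡⟨ cong (∑ᵇ L (Θ [] c) +_) (∑cut-+ L) ⟨
  ∑ᵇ L (Θ [] c) + ∑cut L (λ L₁ d L₂ → Ξ false L₁ d L₂ + Ξ true L₁ d L₂)
    ≡⟨ cong (∑ᵇ L (Θ [] c) +_) (∑cut-cong L λ {L₁} {d} {L₂} _ →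
           sym (∑ᵇ-∷ c L₁ λ P₁ → ∑ᵇ L₂ (Θ P₁ d))) ⟩
  ∑ᵇ L (Θ [] c) + ∑cut L (λ L₁ d L₂ → ∑ᵇ (c ∷ L₁) λ P₁ → ∑ᵇ L₂ (Θ P₁ d))
    ∎
  where
  Θᶜ : Bool → Word _ Bool → _ → Word _ Bool → ℕ
  Θᶜ b P₁ = Θ ((c , b) ∷ P₁)
  Ξ : Bool → List _ → _ → List _ → ℕ
  Ξ b L₁ d L₂ = ∑ᵇ L₁ λ P₁ → ∑ᵇ L₂ (Θᶜ b P₁ d)

zeros ones : Word V Bool → ℕ
zeros []                = 0
zeros ((_ , false) ∷ P) = suc (zeros P)
zeros ((_ , true)  ∷ P) = zeros P
ones  []                = 0
ones  ((_ , false) ∷ P) = ones P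
ones  ((_ , true)  ∷ P) = suc (ones P)

zeros-cut : ∀ (P₁ : Word V Bool) {c P₂} →
            zeros (P₁ ++ (c , false) ∷ P₂) ≡ suc (zeros (P₁ ++ P₂))
zeros-cut []                 = refl
zeros-cut ((_ , false) ∷ P₁) = cong suc (zeros-cut P₁)
zeros-cut ((_ , true)  ∷ P₁) = zeros-cut P₁

ones-cut : ∀ (P₁ : Word V Bool) {c P₂} →
           ones (P₁ ++ (c , false) ∷ P₂) ≡ ones (P₁ ++ P₂)
ones-cut []                 = refl
ones-cut ((_ , false) ∷ P₁) = ones-cut P₁
ones-cut ((_ , true)  ∷ P₁) = cong suc (ones-cut P₁)

_>ᵇ_ : Bool → Bool → Bool
true  >ᵇ false = true
_     >ᵇ _     = false

-- Weights of words

module Weights {W : Set} {_∙_ : W → W → W} {ε : W}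
  (isCommutativeMonoid : IsCommutativeMonoid _≡_ _∙_ ε) {V : Set} where

  commutativeMonoid : CommutativeMonoid _ _
  commutativeMonoid = record { isCommutativeMonoid = isCommutativeMonoid }

  open CommutativeMonoid commutativeMonoid public
    using (assoc; identityˡ; identityʳ; comm; commutativeSemigroup)
  open CommutativeSemigroupProperties commutativeSemigroup public

  ∏ : List A → (A → W) → W
  ∏ xs f = foldr (λ x → f x ∙_) ε xs

  ∏-cong : ∀ (xs : List A) {f g : A → W} → (∀ {x} → x ∈ xs → f x ≡ g x) → ∏ xs f ≡ ∏ xs g
  ∏-cong []       eq = refl
  ∏-cong (x ∷ xs) eq = cong₂ _∙_ (eq (here refl)) (∏-cong xs (eq ∘ there))

  ∏-∙ : ∀ (xs : List A) {f g : A → W} → ∏ xs (λ x → f x ∙ g x) ≡ ∏ xs f ∙ ∏ xs g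
  ∏-∙ []       = sym (identityˡ ε)
  ∏-∙ (x ∷ xs) {f} {g} = trans (cong ((f x ∙ g x) ∙_) (∏-∙ xs)) (interchange _ _ _ _)

  ∏-↭ : ∀ {xs ys : List A} → xs ↭ ys → (f : A → W) → ∏ xs f ≡ ∏ ys f
  ∏-↭ ↭.refl        f = refl
  ∏-↭ (prep x p)    f = cong (f x ∙_) (∏-↭ p f)
  ∏-↭ (swap x y p)  f = trans (x∙yz≈y∙xz _ _ _) (cong (λ z → f y ∙ (f x ∙ z)) (∏-↭ p f))
  ∏-↭ (↭.trans p q) f = trans (∏-↭ p f) (∏-↭ q f)

  ∏-map : ∀ (h : A → B) xs (f : B → W) → ∏ (map h xs) f ≡ ∏ xs (f ∘ h)
  ∏-map h []       f = refl
  ∏-map h (x ∷ xs) f = cong (f (h x) ∙_) (∏-map h xs f)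

  module _ (e : V → V → W) (_≻_ : A → A → Bool) where

    pairWeight : V × A → V × A → W
    pairWeight (u , x) (v , y) = if x ≻ y then e u v else ε

    weight : Word V A → W
    weight []      = ε
    weight (p ∷ P) = ∏ P (pairWeight p) ∙ weight P

  -- Symmetry of sums over two-letter words.

  module TwoLetters (e : V → V → W) {_≺_ : V → V → Set} (q : W)
    (tame : ∀ {u v w} → u ≺ v → v ≺ w → u ≺ w → e u w ≡ ε ⊎ (e u v ≡ q × e v w ≡ q))
    where

    pair : V × Bool → V × Bool → W
    pair = pairWeight e _>ᵇ_

    wt : Word V Bool → W
    wt = weight e _>ᵇ_

    rowWeight : V → Word V Bool → W
    rowWeight v P = ∏ P (pair (v , true))

    columnWeight : Word V Bool → V → W
    columnWeight P c = ∏ P λ p → pair p (c , false)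

    row-cut : ∀ (x : V × Bool) (P₁ : Word V Bool) {c P₂} →
              ∏ (P₁ ++ (c , false) ∷ P₂) (pair x) ≡ pair x (c , false) ∙ ∏ (P₁ ++ P₂) (pair x)
    row-cut x []       = refl
    row-cut x (p ∷ P₁) = trans (cong (pair x p ∙_) (row-cut x P₁)) (x∙yz≈y∙xz _ _ _)

    row-false : ∀ v (P : Word V Bool) → ∏ P (pair (v , false)) ≡ ε
    row-false v []                = refl
    row-false v ((_ , false) ∷ P) = trans (identityˡ _) (row-false v P)
    row-false v ((_ , true) ∷ P)  = trans (identityˡ _) (row-false v P)

    -- A 0 is never the larger letter, so the row of `c` is trivial; deleting `c` loses only its
    -- pairs with earlier vertices.
    wt-cut : ∀ (P₁ : Word V Bool) {c P₂} →
             wt (P₁ ++ (c , false) ∷ P₂) ≡ columnWeight P₁ c ∙ wt (P₁ ++ P₂)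
    wt-cut []       {c} {P₂} = cong (_∙ wt P₂) (row-false c P₂)
    wt-cut (p ∷ P₁) {c} {P₂} = trans (cong₂ _∙_ (row-cut p P₁) (wt-cut P₁)) (interchange _ _ _ _)

    -- The telescoping sum of the header for a single word, with the negative terms
    -- moved to the other side because coefficients are natural numbers.
    telescope : ∀ v (P : Word V Bool) (φ : W → ℕ) w →
      φ w + ∑zero P (λ P₁ c _ → φ (e v c ∙ (rowWeight v P₁ ∙ w))) ≡
      φ (rowWeight v P ∙ w) + ∑zero P (λ P₁ c _ → φ (rowWeight v P₁ ∙ w))
    telescope v []                φ w = cong (λ w → φ w + 0) (sym (identityˡ w))
    telescope v ((c , true) ∷ P)  φ w = begin
      φ w + ∑zero P (λ P₁ d _ → φ (e v d ∙ ((ε ∙ rowWeight v P₁) ∙ w)))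
        ≡⟨ cong (φ w +_) (∑zero-cong P λ {P₁} {d} _ →
             cong (λ r → φ (e v d ∙ (r ∙ w))) (identityˡ (rowWeight v P₁))) ⟩
      φ w + ∑zero P (λ P₁ d _ → φ (e v d ∙ (rowWeight v P₁ ∙ w)))
        ≡⟨ telescope v P φ w ⟩
      φ (rowWeight v P ∙ w) + ∑zero P (λ P₁ d _ → φ (rowWeight v P₁ ∙ w))
        ≡⟨ cong₂ _+_ (cong (λ r → φ (r ∙ w)) (sym (identityˡ (rowWeight v P))))
             (∑zero-cong P λ {P₁} _ → cong (λ r → φ (r ∙ w)) (sym (identityˡ (rowWeight v P₁)))) ⟩
      φ ((ε ∙ rowWeight v P) ∙ w) + ∑zero P (λ P₁ d _ → φ ((ε ∙ rowWeight v P₁) ∙ w)) ∎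
    telescope v ((c , false) ∷ P) φ w = begin
      φ w + (φ (e v c ∙ (ε ∙ w)) + ∑zero P (λ P₁ d _ → φ (e v d ∙ ((e v c ∙ rowWeight v P₁) ∙ w))))
        ≡⟨ cong (φ w +_) (cong₂ _+_ (cong (λ z → φ (e v c ∙ z)) (identityˡ w))
             (∑zero-cong P λ {P₁} {d} _ → cong (λ z → φ (e v d ∙ z)) (xy∙z≈y∙xz _ _ _))) ⟩
      φ w + (φ (e v c ∙ w) + ∑zero P (λ P₁ d _ → φ (e v d ∙ (rowWeight v P₁ ∙ (e v c ∙ w)))))
        -- The factor `e v c` occurs in every later partial product, so it is absorbed into `w`; for
        -- this the induction keeps `w` arbitrary.
        ≡⟨ cong (φ w +_) (telescope v P φ (e v c ∙ w)) ⟩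
      φ w + (φ (rowWeight v P ∙ (e v c ∙ w)) + ∑zero P (λ P₁ d _ → φ (rowWeight v P₁ ∙ (e v c ∙ w))))
        ≡⟨ +-swap (φ w) (φ (rowWeight v P ∙ (e v c ∙ w))) _ ⟩
      φ (rowWeight v P ∙ (e v c ∙ w)) + (φ w + ∑zero P (λ P₁ d _ → φ (rowWeight v P₁ ∙ (e v c ∙ w))))
        ≡⟨ cong₂ _+_ (cong φ (sym (xy∙z≈y∙xz _ _ _)))
             (cong₂ _+_ (cong φ (sym (identityˡ w)))
               (∑zero-cong P λ {P₁} {d} _ → cong φ (sym (xy∙z≈y∙xz _ _ _)))) ⟩
      φ ((e v c ∙ rowWeight v P) ∙ w) +
        (φ (ε ∙ w) + ∑zero P (λ P₁ d _ → φ ((e v c ∙ rowWeight v P₁) ∙ w))) ∎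

    data Cut (v : V) (L₁ : List V) (c : V) : Set where
      free  : e v c ≡ ε → Cut v L₁ c
      clique : All (λ u → e v u ≡ q × e u c ≡ q) L₁ → Cut v L₁ c

    -- Apply `tame` to `v`, each `u` of `L₁` and `c`: as soon as its first alternative occurs,
    -- `e v c` is trivial, and otherwise every `u` has both edges equal to `q`. The clique case
    -- leaves `e v c` itself arbitrary, which makes room for the edges of descents.
    cut : ∀ {v L₁ c L₂} → AllPairs _≺_ (v ∷ L₁ ++ c ∷ L₂) → Cut v L₁ c
    cut {L₁ = []}             _ = clique []
    cut {L₁ = u ∷ L₁} {c} ((v≺u ∷ v≺L) ∷ (u≺L ∷ sorted))
      with tame v≺u (All.head (All.++⁻ʳ L₁ u≺L)) (All.head (All.++⁻ʳ L₁ v≺L))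
    ... | inj₁ free-vc = free free-vc
    ... | inj₂ q,q with cut {L₁ = L₁} (v≺L ∷ sorted)
    ...   | free free-vc = free free-vc
    ...   | clique all    = clique (q,q ∷ all)

    powerOf : List V → W
    powerOf L = ∏ L λ _ → q

    -- A 0 of P₁ is counted by the rowWeight of v, a 1 by the columnWeight of c.
    row∙column : ∀ {v c L₁ P₁} → All (λ u → e v u ≡ q × e u c ≡ q) L₁ →
                 Over bits L₁ P₁ → rowWeight v P₁ ∙ columnWeight P₁ c ≡ powerOf L₁
    row∙column [] [] = identityˡ ε
    row∙column ((vu , uc) ∷ all) ((refl , here refl) ∷ over) =
      trans (interchange _ _ _ _) (cong₂ _∙_ (trans (identityʳ _) vu) (row∙column all over))
    row∙column ((vu , uc) ∷ all) ((refl , there (here refl)) ∷ over) =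
      trans (interchange _ _ _ _) (cong₂ _∙_ (trans (identityˡ _) uc) (row∙column all over))

    -- The arguments are the number of zeros, the number of ones and the weight. A statement about
    -- all such functions stands in for an identity of generating functions, and the contribution of
    -- a deleted vertex is absorbed by changing the function.
    Stat : Set
    Stat = ℕ → ℕ → W → ℕ

    total : List V → Stat → ℕ
    total L Ψ = ∑ᵇ L λ P → Ψ (zeros P) (ones P) (wt P)

    module _ (v : V) where

      -- The terms of the telescoping sum with and without the factor `e v c`, expressed by the word
      -- `P₁ ++ P₂` from which `c` is deleted. The `suc` counts the zero at `c`.
      lowerAt upperAt : Stat → Word V Bool → V → Word V Bool → ℕ
      lowerAt Ψ P₁ c P₂ = Ψ (suc (zeros (P₁ ++ P₂))) (ones (P₁ ++ P₂))
        (e v c ∙ (rowWeight v P₁ ∙ (columnWeight P₁ c ∙ wt (P₁ ++ P₂))))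
      upperAt Ψ P₁ c P₂ = Ψ (suc (zeros (P₁ ++ P₂))) (ones (P₁ ++ P₂))
        (rowWeight v P₁ ∙ (columnWeight P₁ c ∙ wt (P₁ ++ P₂)))

      lower upper : Stat → List V → V → List V → ℕ
      lower Ψ L₁ c L₂ = ∑ᵇ L₁ λ P₁ → ∑ᵇ L₂ (lowerAt Ψ P₁ c)
      upper Ψ L₁ c L₂ = ∑ᵇ L₁ λ P₁ → ∑ᵇ L₂ (upperAt Ψ P₁ c)

      rowTotal : List V → Stat → ℕ
      rowTotal L Ψ = ∑ᵇ L λ P → Ψ (zeros P) (ones P) (rowWeight v P ∙ wt P)

      -- Sum `telescope` over all words on `L`, with `w` the weight of the word, and rewrite each
      -- term by `wt-cut`.
      telescope-total : ∀ L Ψ → total L Ψ + ∑cut L (lower Ψ) ≡ rowTotal L Ψ + ∑cut L (upper Ψ)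
      telescope-total L Ψ = begin
        total L Ψ + ∑cut L (lower Ψ)
          ≡⟨ cong (total L Ψ +_) (∑ᵇ-∑zero L) ⟨
        total L Ψ + ∑ᵇ L (λ P → ∑zero P (lowerAt Ψ))
          ≡⟨ ∑ʷ-+ bits L ⟨
        ∑ᵇ L (λ P → Ψ (zeros P) (ones P) (wt P) + ∑zero P (lowerAt Ψ))
          ≡⟨ ∑ʷ-cong bits L (λ {P} _ → step P) ⟩
        ∑ᵇ L (λ P → Ψ (zeros P) (ones P) (rowWeight v P ∙ wt P) + ∑zero P (upperAt Ψ))
          ≡⟨ ∑ʷ-+ bits L ⟩
        rowTotal L Ψ + ∑ᵇ L (λ P → ∑zero P (upperAt Ψ))
          ≡⟨ cong (rowTotal L Ψ +_) (∑ᵇ-∑zero L) ⟩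
        rowTotal L Ψ + ∑cut L (upper Ψ) ∎
        where
        Ψ-cut : ∀ {P P₁ c P₂} → P ≡ P₁ ++ (c , false) ∷ P₂ → (f : W → W) →
                Ψ (suc (zeros (P₁ ++ P₂))) (ones (P₁ ++ P₂)) (f (columnWeight P₁ c ∙ wt (P₁ ++ P₂))) ≡
                Ψ (zeros P) (ones P) (f (wt P))
        Ψ-cut {P₁ = P₁} {c} {P₂} refl f
          rewrite zeros-cut P₁ {c} {P₂} | ones-cut P₁ {c} {P₂} | wt-cut P₁ {c} {P₂} = refl

        step : ∀ P → Ψ (zeros P) (ones P) (wt P) + ∑zero P (lowerAt Ψ) ≡
                     Ψ (zeros P) (ones P) (rowWeight v P ∙ wt P) + ∑zero P (upperAt Ψ)
        step P = begin
          φ (wt P) + ∑zero P (lowerAt Ψ)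
            ≡⟨ cong (φ (wt P) +_) (∑zero-cong P λ {P₁} {c} eq →
                 Ψ-cut eq λ w → e v c ∙ (rowWeight v P₁ ∙ w)) ⟩
          φ (wt P) + ∑zero P (λ P₁ c _ → φ (e v c ∙ (rowWeight v P₁ ∙ wt P)))
            ≡⟨ telescope v P φ (wt P) ⟩
          φ (rowWeight v P ∙ wt P) + ∑zero P (λ P₁ c _ → φ (rowWeight v P₁ ∙ wt P))
            ≡⟨ cong (φ (rowWeight v P ∙ wt P) +_) (∑zero-cong P λ {P₁} eq →
                 Ψ-cut eq λ w → rowWeight v P₁ ∙ w) ⟨
          φ (rowWeight v P ∙ wt P) + ∑zero P (upperAt Ψ) ∎
          where
          φ : W → ℕ
          φ = Ψ (zeros P) (ones P)

      -- The first vertex is only ever the left member of a pair: as a 0 it does not affect the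
      -- weight, as a 1 it contributes its row.
      total-∷ : ∀ L Φ → total (v ∷ L) Φ ≡
                total L (λ z o w → Φ (suc z) o w) + rowTotal L (λ z o w → Φ z (suc o) w)
      total-∷ L Φ = trans (∑ᵇ-∷ v L λ P → Φ (zeros P) (ones P) (wt P))
        (cong (_+ rowTotal L λ z o w → Φ z (suc o) w)
          (∑ʷ-cong bits L λ {P} _ →
            cong (Φ _ _) (trans (cong (_∙ wt P) (row-false v P)) (identityˡ _))))

      module _ {L₁ : List V} {c : V} {L₂ : List V}
        (all : All (λ u → e v u ≡ q × e u c ≡ q) L₁) (Ψ : Stat) where

        cut-weight : ∀ {P₁} w → Over bits L₁ P₁ →
                     rowWeight v P₁ ∙ (columnWeight P₁ c ∙ w) ≡ powerOf L₁ ∙ w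
        cut-weight {P₁} w over = trans (sym (assoc _ _ _)) (cong (_∙ w) (row∙column all over))

        -- The row of `v` and the column of `c` multiply to a constant by `row∙column`, so the sums
        -- over the two sides of the cut join into one sum over words on `L₁ ++ L₂`.
        lower-clique : lower Ψ L₁ c L₂ ≡
                      total (L₁ ++ L₂) λ z o w → Ψ (suc z) o (e v c ∙ (powerOf L₁ ∙ w))
        lower-clique = trans
          (∑ʷ-cong bits L₁ λ over → ∑ʷ-cong bits L₂ λ _ →
            cong (λ w → Ψ _ _ (e v c ∙ w)) (cut-weight _ over))
          (sym (∑ʷ-++ bits L₁ L₂))

        upper-clique : upper Ψ L₁ c L₂ ≡
                      total (L₁ ++ L₂) λ z o w → Ψ (suc z) o (powerOf L₁ ∙ w)
        upper-clique = trans
          (∑ʷ-cong bits L₁ λ over → ∑ʷ-cong bits L₂ λ _ → cong (Ψ _ _) (cut-weight _ over))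
          (sym (∑ʷ-++ bits L₁ L₂))

      lower≡upper : ∀ L₁ {c} L₂ Ψ → e v c ≡ ε → lower Ψ L₁ c L₂ ≡ upper Ψ L₁ c L₂
      lower≡upper L₁ {c} L₂ Ψ free-vc =
        ∑ʷ-cong bits L₁ λ _ → ∑ʷ-cong bits L₂ λ _ → cong (Ψ _ _) (absorb _)
        where
        absorb : ∀ w → e v c ∙ w ≡ w
        absorb w = trans (cong (_∙ w) free-vc) (identityˡ w)

    AllPairs-remove : ∀ L₁ {c : V} {L₂} → AllPairs _≺_ (L₁ ++ c ∷ L₂) → AllPairs _≺_ (L₁ ++ L₂)
    AllPairs-remove []       (_ ∷ sorted)   = sorted
    AllPairs-remove (u ∷ L₁) (u≺L ∷ sorted) =
      All.++⁺ (All.++⁻ˡ L₁ u≺L) (All.tail (All.++⁻ʳ L₁ u≺L)) ∷ AllPairs-remove L₁ sorted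

    -- The induction runs on a bound for the length, because its hypothesis is applied both to the
    -- tail and to the tail with one more vertex deleted.
    total-symmetric : ∀ n L → length L ≤ n → AllPairs _≺_ L → ∀ Φ →
                      total L Φ ≡ total L λ z o w → Φ o z w
    total-symmetric n       []      _         _                Φ = refl
    total-symmetric (suc n) (v ∷ L) (s≤s L≤n) sorted@(_ ∷ sortedᴸ) Φ =
      -- In terms of differences, the induction hypothesis reduces the claim to `rowTotal` minus
      -- `total` being the same for `Ψ₁` and `Ψ₂`. By `telescope-total` this difference is the sum
      -- of `lower` minus `upper` over all cuts, which `cross` compares. The cancelled summand keeps
      -- everything within the natural numbers.
      +-cancelʳ-≡ (∑cut L (lower v Ψ₁) + ∑cut L (upper v Ψ₂)) _ _ (begin
        total (v ∷ L) Φ + (∑cut L (lower v Ψ₁) + ∑cut L (upper v Ψ₂))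
          ≡⟨ cong₂ _+_ (trans (total-∷ v L Φ)
               (cong (_+ rowTotal v L Ψ₁) (IH λ z o w → Φ (suc z) o w))) cross ⟩
        (total L Ψ₂ + rowTotal v L Ψ₁) + (∑cut L (lower v Ψ₂) + ∑cut L (upper v Ψ₁))
          ≡⟨ +-interchange (total L Ψ₂) _ _ _ ⟩
        (total L Ψ₂ + ∑cut L (lower v Ψ₂)) + (rowTotal v L Ψ₁ + ∑cut L (upper v Ψ₁))
          ≡⟨ cong₂ _+_ (telescope-total v L Ψ₂) (sym (telescope-total v L Ψ₁)) ⟩
        (rowTotal v L Ψ₂ + ∑cut L (upper v Ψ₂)) + (total L Ψ₁ + ∑cut L (lower v Ψ₁))
          ≡⟨ regroup (rowTotal v L Ψ₂) (∑cut L (upper v Ψ₂)) (total L Ψ₁) (∑cut L (lower v Ψ₁)) ⟩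
        (total L Ψ₁ + rowTotal v L Ψ₂) + (∑cut L (lower v Ψ₁) + ∑cut L (upper v Ψ₂))
          ≡⟨ cong (_+ (∑cut L (lower v Ψ₁) + ∑cut L (upper v Ψ₂)))
               (trans (total-∷ v L λ z o w → Φ o z w)
                 (cong (_+ rowTotal v L Ψ₂) (IH λ z o w → Φ o (suc z) w))) ⟨
        total (v ∷ L) (λ z o w → Φ o z w) + (∑cut L (lower v Ψ₁) + ∑cut L (upper v Ψ₂)) ∎)
      where
      Ψ₁ Ψ₂ : Stat
      Ψ₁ z o w = Φ z (suc o) w
      Ψ₂ z o w = Φ (suc o) z w

      regroup : ∀ a b c d → (a + b) + (c + d) ≡ (c + a) + (d + b)
      regroup = solve-∀

      IH : ∀ Ψ → total L Ψ ≡ total L λ z o w → Ψ o z w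
      IH = total-symmetric n L L≤n sortedᴸ

      cross : ∑cut L (lower v Ψ₁) + ∑cut L (upper v Ψ₂) ≡ ∑cut L (lower v Ψ₂) + ∑cut L (upper v Ψ₁)
      cross = trans (sym (∑cut-+ L)) (trans (∑cut-cong L crossAt) (∑cut-+ L))
        where
        crossAt : ∀ {L₁ c L₂} → L ≡ L₁ ++ c ∷ L₂ →
                  lower v Ψ₁ L₁ c L₂ + upper v Ψ₂ L₁ c L₂ ≡ lower v Ψ₂ L₁ c L₂ + upper v Ψ₁ L₁ c L₂
        crossAt {L₁} {c} {L₂} refl with cut sorted
        ... | free vc    = trans
          (cong₂ _+_ (lower≡upper v L₁ L₂ Ψ₁ vc) (sym (lower≡upper v L₁ L₂ Ψ₂ vc)))
          (+-comm (upper v Ψ₁ L₁ c L₂) (lower v Ψ₂ L₁ c L₂))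
        -- Here `v` is a 1 and `c` a 0. With both deleted, the two functions evaluate `Φ` at
        -- `(suc z , suc o)` and at `(suc o , suc z)`, and the induction hypothesis for `L₁ ++ L₂`
        -- exchanges these.
        ... | clique all = cong₂ _+_
          (trans (lower-clique v all Ψ₁) (trans
            (IH′ λ z o w → Φ (suc z) (suc o) (e v c ∙ (powerOf L₁ ∙ w)))
            (sym (lower-clique v all Ψ₂))))
          (trans (upper-clique v all Ψ₂) (trans
            (IH′ λ z o w → Φ (suc o) (suc z) (powerOf L₁ ∙ w))
            (sym (upper-clique v all Ψ₁))))
          where
          IH′ : ∀ Ψ → total (L₁ ++ L₂) Ψ ≡ total (L₁ ++ L₂) λ z o w → Ψ o z w
          IH′ = total-symmetric n (L₁ ++ L₂)
            (≤-trans (n≤1+n _) (≤-trans (≤-reflexive (sym (length-++-sucʳ L₁ c L₂))) L≤n))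
            (AllPairs-remove L₁ sortedᴸ)

-- Letters and monomials

indicator-cong : ∀ {P Q : Set} (P? : Dec P) (Q? : Dec Q) → (P → Q) → (Q → P) →
                 indicator P? ≡ indicator Q?
indicator-cong (yes p) (yes q) f g = refl
indicator-cong (yes p) (no ¬q) f g = ⊥-elim (¬q (f p))
indicator-cong (no ¬p) (yes q) f g = ⊥-elim (¬p (g q))
indicator-cong (no ¬p) (no ¬q) f g = refl

indicator-yes : ∀ {P : Set} (P? : Dec P) → P → indicator P? ≡ 1
indicator-yes (yes _) _ = refl
indicator-yes (no ¬p) p = ⊥-elim (¬p p)

indicator-no : ∀ {P : Set} (P? : Dec P) → (P → ⊥) → indicator P? ≡ 0
indicator-no (yes p) ¬p = ⊥-elim (¬p p)
indicator-no (no _)  _  = refl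

monomial : List ℕ → Monomial
monomial xs = foldr _·_ 1ᴹ (map var xs)

exponent-monomial : ∀ xs k → exponent (monomial xs) k ≡ ∑ xs λ x → indicator (x ≟ k)
exponent-monomial []       k = refl
exponent-monomial (x ∷ xs) k = cong (indicator (x ≟ k) +_) (exponent-monomial xs k)

content : Word V ℕ → Monomial
content P = monomial (map proj₂ P)

∑-map : ∀ (h : A → B) xs (f : B → ℕ) → ∑ (map h xs) f ≡ ∑ xs (f ∘ h)
∑-map h xs f = cong sum (sym (map-∘ xs))

∑-replicate : ∀ n (x : A) (f : A → ℕ) → ∑ (replicate n x) f ≡ n * f x
∑-replicate zero    x f = refl
∑-replicate (suc n) x f = cong (f x +_) (∑-replicate n x f)

_>ᴺ_ : ℕ → ℕ → Bool
x >ᴺ y = does (y <? x)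

>ᴺ-irrefl : ∀ x → x >ᴺ x ≡ false
>ᴺ-irrefl x = dec-false (x <? x) (<-irrefl refl)

module _ {W : Set} {_∙_ : W → W → W} {ε : W}
  (isCommutativeMonoid : IsCommutativeMonoid _≡_ _∙_ ε) {V : Set} (e : V → V → W)
  where

  open Weights isCommutativeMonoid {V}

  summand : Monomial → (W → ℕ) → Word V ℕ → ℕ
  summand α φ P = indicator (content P ≈? α) * φ (weight e _>ᴺ_ P)

-- A skeleton records the letters of a word other than a and a + 1, leaving
-- holes at the remaining places.

module Skeleton (a : ℕ) where

  letter : Bool → ℕ
  letter false = a
  letter true  = suc a

  Outside : ℕ → Set
  Outside x = x ≢ a × x ≢ suc a

  Clean : Word V (Maybe ℕ) → Set
  Clean = All (Maybe.All Outside ∘ proj₂)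

  merge : Word V (Maybe ℕ) → Word V Bool → Word V ℕ
  merge []                  P             = []
  merge ((v , just x)  ∷ S) P             = (v , x) ∷ merge S P
  -- Junk value: a word over `holes S` never runs out at a hole.
  merge ((v , nothing) ∷ S) []            = []
  merge ((v , nothing) ∷ S) ((_ , b) ∷ P) = (v , letter b) ∷ merge S P

  holes : Word V (Maybe ℕ) → List V
  holes []                  = []
  holes ((v , just _)  ∷ S) = holes S
  holes ((v , nothing) ∷ S) = v ∷ holes S

  -- Once `a` and `suc a` head the alphabet, each letter is either one of these two, recorded as a
  -- hole and chosen in the inner sum, or a letter of `Y`.
  ∑ʷ-skeleton : ∀ {X Y} → X ↭ a ∷ suc a ∷ Y → (L : List V) (F : Word V ℕ → ℕ) →
    ∑ʷ X L F ≡ ∑ʷ (nothing ∷ map just Y) L λ S → ∑ᵇ (holes S) (F ∘ merge S)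
  ∑ʷ-skeleton {X = X} {Y} X↭ L F = trans (∑ʷ-letters-↭ X↭ L) (go L F)
    where
    Z = nothing ∷ map just Y
    go : ∀ L F → ∑ʷ (a ∷ suc a ∷ Y) L F ≡ ∑ʷ Z L λ S → ∑ᵇ (holes S) (F ∘ merge S)
    go []      F = refl
    go (v ∷ L) F = begin
      G a + (G (suc a) + ∑ Y G)
        ≡⟨ +-assoc (G a) _ _ ⟨
      G a + G (suc a) + ∑ Y G
        ≡⟨ cong₂ _+_ (cong₂ _+_ (go L _) (go L _)) (∑-cong Y λ _ → go L _) ⟩
      H false + H true + ∑ Y (λ y → ∑ʷ Z L λ S → ∑ᵇ (holes S) λ P → F ((v , y) ∷ merge S P))
        ≡⟨ cong₂ _+_ (sym (∑ʷ-+ Z L)) (sym (∑-map just Y K)) ⟩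
      ∑ʷ Z L (λ S → ∑ᵇ (holes S) (λ P → F ((v , a) ∷ merge S P)) +
                    ∑ᵇ (holes S) (λ P → F ((v , suc a) ∷ merge S P))) + ∑ (map just Y) K
        ≡⟨ cong (_+ ∑ (map just Y) K) (∑ʷ-cong Z L λ {S} _ →
             sym (∑ᵇ-∷ v (holes S) (F ∘ merge ((v , nothing) ∷ S)))) ⟩
      ∑ʷ Z (v ∷ L) (λ S → ∑ᵇ (holes S) (F ∘ merge S)) ∎
      where
      G : ℕ → ℕ
      G x = ∑ʷ (a ∷ suc a ∷ Y) L λ P → F ((v , x) ∷ P)
      H : Bool → ℕ
      H b = ∑ʷ Z L λ S → ∑ᵇ (holes S) λ P → F ((v , letter b) ∷ merge S P)
      K : Maybe ℕ → ℕ
      K m = ∑ʷ Z L λ S → ∑ᵇ (holes ((v , m) ∷ S)) (F ∘ merge ((v , m) ∷ S))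

  clean : ∀ {Y} {L : List V} {S} → All Outside Y → Over (nothing ∷ map just Y) L S → Clean S
  clean outside [] = []
  clean outside ((_ , here refl) ∷ over) = nothing ∷ clean outside over
  clean outside ((_ , there m∈) ∷ over) with ∈.∈-map⁻ just m∈
  ... | y , y∈Y , refl = just (All.lookup outside y∈Y) ∷ clean outside over

  exponent-merge : ∀ (S : Word V (Maybe ℕ)) {P} → Over bits (holes S) P → ∀ k →
    exponent (content (merge S P)) k ≡
    zeros P * indicator (a ≟ k) +
      (ones P * indicator (suc a ≟ k) + exponent (monomial (mapMaybe proj₂ S)) k)
  exponent-merge []                  []            k = refl
  exponent-merge ((v , just x)  ∷ S) {P} over      k =
    trans (cong (indicator (x ≟ k) +_) (exponent-merge S over k))
      (trans (+-swap (indicator (x ≟ k)) (zeros P * _) _)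
             (cong (zeros P * indicator (a ≟ k) +_) (+-swap (indicator (x ≟ k)) (ones P * _) _)))
  exponent-merge ((v , nothing) ∷ S) {(_ , false) ∷ P} (_ ∷ over) k =
    trans (cong (indicator (a ≟ k) +_) (exponent-merge S over k))
          (sym (+-assoc (indicator (a ≟ k)) _ _))
  exponent-merge ((v , nothing) ∷ S) {(_ , true) ∷ P} (_ ∷ over) k =
    trans (cong (indicator (suc a ≟ k) +_) (exponent-merge S over k))
      (trans (+-swap (indicator (suc a ≟ k)) (zeros P * _) _)
             (cong (zeros P * indicator (a ≟ k) +_) (sym (+-assoc (indicator (suc a ≟ k)) _ _))))

  -- The content of a merged word depends on the two-letter word only through its `z` zeros and `o`
  -- ones; this is the monomial they determine.
  fillHoles : List ℕ → ℕ → ℕ → Monomial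
  fillHoles xs z o = monomial (replicate z a ++ replicate o (suc a) ++ xs)

  exponent-fillHoles : ∀ xs z o k → exponent (fillHoles xs z o) k ≡
    z * indicator (a ≟ k) + (o * indicator (suc a ≟ k) + exponent (monomial xs) k)
  exponent-fillHoles xs z o k = begin
    exponent (fillHoles xs z o) k
      ≡⟨ exponent-monomial (replicate z a ++ replicate o (suc a) ++ xs) k ⟩
    ∑ (replicate z a ++ replicate o (suc a) ++ xs) i
      ≡⟨ trans (∑-++ (replicate z a) _ i)
           (cong (∑ (replicate z a) i +_) (∑-++ (replicate o (suc a)) xs i)) ⟩
    ∑ (replicate z a) i + (∑ (replicate o (suc a)) i + ∑ xs i)
      ≡⟨ cong₂ _+_ (∑-replicate z a i)
           (cong₂ _+_ (∑-replicate o (suc a) i) (sym (exponent-monomial xs k))) ⟩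
    z * i a + (o * i (suc a) + exponent (monomial xs) k) ∎
    where
    i : ℕ → ℕ
    i x = indicator (x ≟ k)

  content-merge : ∀ (S : Word V (Maybe ℕ)) {P} → Over bits (holes S) P →
    content (merge S P) ≈ fillHoles (mapMaybe proj₂ S) (zeros P) (ones P)
  content-merge S {P} over k =
    trans (exponent-merge S over k)
          (sym (exponent-fillHoles (mapMaybe proj₂ S) (zeros P) (ones P) k))

  record Swapped (α β : Monomial) : Set where
    field
      at-a    : exponent β a ≡ exponent α (suc a)
      at-1+a  : exponent β (suc a) ≡ exponent α a
      outside : ∀ k → Outside k → exponent β k ≡ exponent α k

  Swapped-sym : ∀ {α β} → Swapped α β → Swapped β α
  Swapped-sym s = record
    { at-a = sym at-1+a ; at-1+a = sym at-a ; outside = λ k o → sym (outside k o) }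
    where open Swapped s

  monomial-outside : ∀ {k} xs → All (_≢ k) xs → exponent (monomial xs) k ≡ 0
  monomial-outside []       []             = refl
  monomial-outside (x ∷ xs) (x≢k ∷ xs≢k) =
    cong₂ _+_ (indicator-no (x ≟ _) x≢k) (monomial-outside xs xs≢k)

  module _ {xs : List ℕ} (out : All Outside xs) where

    fillHoles-a : ∀ z o → exponent (fillHoles xs z o) a ≡ z
    fillHoles-a z o
      rewrite exponent-fillHoles xs z o a
            | indicator-yes (a ≟ a) refl | indicator-no (suc a ≟ a) 1+n≢n
            | monomial-outside xs (All.map proj₁ out)
            | *-identityʳ z | *-zeroʳ o = +-identityʳ z

    fillHoles-1+a : ∀ z o → exponent (fillHoles xs z o) (suc a) ≡ o
    fillHoles-1+a z o
      rewrite exponent-fillHoles xs z o (suc a)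
            | indicator-no (a ≟ suc a) (1+n≢n ∘ sym) | indicator-yes (suc a ≟ suc a) refl
            | monomial-outside xs (All.map proj₂ out)
            | *-identityʳ o | *-zeroʳ z = +-identityʳ o

    fillHoles-outside : ∀ z o k → Outside k →
                        exponent (fillHoles xs z o) k ≡ exponent (monomial xs) k
    fillHoles-outside z o k (k≢a , k≢1+a)
      rewrite exponent-fillHoles xs z o k
            | indicator-no (a ≟ k) (k≢a ∘ sym) | indicator-no (suc a ≟ k) (k≢1+a ∘ sym)
            | *-zeroʳ z | *-zeroʳ o = refl

    -- Since `xs` avoids both letters, the exponents at `a` and `suc a` are exactly `z` and `o`.
    fillHoles-swap : ∀ {α β} → Swapped α β → ∀ z o →
                     fillHoles xs z o ≈ α → fillHoles xs o z ≈ β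
    fillHoles-swap {α} {β} swapped z o eq k with k ≟ a
    ... | yes refl = begin
      exponent (fillHoles xs o z) a       ≡⟨ fillHoles-a o z ⟩
      o                                   ≡⟨ fillHoles-1+a z o ⟨
      exponent (fillHoles xs z o) (suc a) ≡⟨ eq (suc a) ⟩
      exponent α (suc a)                  ≡⟨ Swapped.at-a swapped ⟨
      exponent β a                        ∎
    ... | no k≢a with k ≟ suc a
    ...   | yes refl = begin
      exponent (fillHoles xs o z) (suc a) ≡⟨ fillHoles-1+a o z ⟩
      z                                   ≡⟨ fillHoles-a z o ⟨
      exponent (fillHoles xs z o) a       ≡⟨ eq a ⟩
      exponent α a                        ≡⟨ Swapped.at-1+a swapped ⟨
      exponent β (suc a)                  ∎
    ...   | no k≢1+a = begin
      exponent (fillHoles xs o z) k ≡⟨ fillHoles-outside o z k (k≢a , k≢1+a) ⟩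
      exponent (monomial xs) k      ≡⟨ fillHoles-outside z o k (k≢a , k≢1+a) ⟨
      exponent (fillHoles xs z o) k ≡⟨ eq k ⟩
      exponent α k                  ≡⟨ Swapped.outside swapped k (k≢a , k≢1+a) ⟨
      exponent β k                  ∎

  clean⇒outside : ∀ {S : Word V (Maybe ℕ)} → Clean S → All Outside (mapMaybe proj₂ S)
  clean⇒outside {S = []}                []               = []
  clean⇒outside {S = (_ , just _)  ∷ _} (just out ∷ cl)  = out ∷ clean⇒outside cl
  clean⇒outside {S = (_ , nothing) ∷ _} (nothing ∷ cl)   = clean⇒outside cl

  -- Holes are compared with the other letters as a is, and not with each other.
  _>ᵐ_ : Maybe ℕ → Maybe ℕ → Bool
  just x  >ᵐ just y  = x >ᴺ y
  just x  >ᵐ nothing = x >ᴺ a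
  nothing >ᵐ just y  = a >ᴺ y
  nothing >ᵐ nothing = false

  -- No integer lies strictly between `a` and `suc a`, so any other letter compares in the same way
  -- with both.
  outside>letter : ∀ {x} → Outside x → ∀ b → x >ᴺ letter b ≡ x >ᴺ a
  outside>letter         _           false = refl
  outside>letter {x} (_ , x≢1+a) true with a <? x
  ... | yes a<x = trans (dec-true (suc a <? x) (≤∧≢⇒< a<x (x≢1+a ∘ sym)))
                        (sym (dec-true (a <? x) a<x))
  ... | no  a≮x = trans (dec-false (suc a <? x) (a≮x ∘ <-trans (n<1+n a)))
                        (sym (dec-false (a <? x) a≮x))

  letter>outside : ∀ {y} → Outside y → ∀ b → letter b >ᴺ y ≡ a >ᴺ y
  letter>outside         _           false = refl
  letter>outside {y} (y≢a , _) true with y <? a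
  ... | yes y<a = trans (dec-true (y <? suc a) (m<n⇒m<1+n y<a)) (sym (dec-true (y <? a) y<a))
  ... | no  y≮a = trans (dec-false (y <? suc a) λ y<1+a → y≮a (≤∧≢⇒< (s≤s⁻¹ y<1+a) y≢a))
                        (sym (dec-false (y <? a) y≮a))

  letter>letter : ∀ b c → letter b >ᴺ letter c ≡ b >ᵇ c
  letter>letter false false = dec-false (a <? a) (<-irrefl refl)
  letter>letter false true  = dec-false (suc a <? a) (<⇒≱ (n<1+n a) ∘ <⇒≤)
  letter>letter true  false = dec-true (a <? suc a) (n<1+n a)
  letter>letter true  true  = dec-false (suc a <? suc a) (<-irrefl refl)

  module _ {_≺_ : V → V → Set} {X : List (Maybe ℕ)} where

    holes-All : ∀ {u L S} → All (u ≺_) L → Over X L S → All (u ≺_) (holes S)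
    holes-All []         []                                     = []
    holes-All (_   ∷ ≺L) (_∷_ {y = _ , just _}  (refl , _) over) = holes-All ≺L over
    holes-All (u≺v ∷ ≺L) (_∷_ {y = _ , nothing} (refl , _) over) = u≺v ∷ holes-All ≺L over

    holes-sorted : ∀ {L S} → AllPairs _≺_ L → Over X L S → AllPairs _≺_ (holes S)
    holes-sorted []            []                                     = []
    holes-sorted (_  ∷ sorted) (_∷_ {y = _ , just _}  (refl , _) over) = holes-sorted sorted over
    holes-sorted (≺L ∷ sorted) (_∷_ {y = _ , nothing} (refl , _) over) =
      holes-All ≺L over ∷ holes-sorted sorted over

  module _ {W : Set} {_∙_ : W → W → W} {ε : W}
    (isCommutativeMonoid : IsCommutativeMonoid _≡_ _∙_ ε) {V : Set} (e : V → V → W)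
    where

    open Weights isCommutativeMonoid {V}

    row-just : ∀ u {x} → Outside x → ∀ {S P} → Clean S → Over bits (holes S) P →
      ∏ (merge S P) (pairWeight e _>ᴺ_ (u , x)) ≡ ∏ S (pairWeight e _>ᵐ_ (u , just x))
    row-just u out {[]}                []             []       = refl
    row-just u {x} out {(v , just y)  ∷ S} (_ ∷ cl) over =
      cong ((if x >ᴺ y then e u v else ε) ∙_) (row-just u out cl over)
    row-just u out {(v , nothing) ∷ S} {(_ , b) ∷ _} (_ ∷ cl) (_ ∷ over) =
      cong₂ _∙_ (cong (if_then e u v else ε) (outside>letter out b)) (row-just u out cl over)

    row-letter : ∀ u b {S P} → Clean S → Over bits (holes S) P →
      ∏ (merge S P) (pairWeight e _>ᴺ_ (u , letter b)) ≡
      ∏ S (pairWeight e _>ᵐ_ (u , nothing)) ∙ ∏ P (pairWeight e _>ᵇ_ (u , b))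
    row-letter u b {[]} [] [] = sym (identityˡ ε)
    row-letter u b {(v , just y) ∷ S} {P} (just out ∷ cl) over =
      trans (cong₂ _∙_ (cong (if_then e u v else ε) (letter>outside out b)) (row-letter u b cl over))
            (sym (assoc _ _ _))
    row-letter u b {(v , nothing) ∷ S} {(_ , c) ∷ P} (_ ∷ cl) ((refl , _) ∷ over) = begin
      (if letter b >ᴺ letter c then e u v else ε) ∙ ∏ (merge S P) (pairWeight e _>ᴺ_ (u , letter b))
        ≡⟨ cong₂ _∙_ (cong (if_then e u v else ε) (letter>letter b c)) (row-letter u b cl over) ⟩
      pairWeight e _>ᵇ_ (u , b) (v , c) ∙ (rowS ∙ ∏ P (pairWeight e _>ᵇ_ (u , b)))
        ≡⟨ x∙yz≈y∙xz _ _ _ ⟩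
      rowS ∙ (pairWeight e _>ᵇ_ (u , b) (v , c) ∙ ∏ P (pairWeight e _>ᵇ_ (u , b)))
        ≡⟨ cong (_∙ _) (identityˡ rowS) ⟨
      (ε ∙ rowS) ∙ (pairWeight e _>ᵇ_ (u , b) (v , c) ∙ ∏ P (pairWeight e _>ᵇ_ (u , b))) ∎
      where rowS = ∏ S (pairWeight e _>ᵐ_ (u , nothing))

    -- A pair with at most one hole has the same weight whichever letter fills the hole, so it
    -- belongs to the skeleton. The pairs of two holes make up the weight of the two-letter word.
    weight-merge : ∀ {S P} → Clean S → Over bits (holes S) P →
      weight e _>ᴺ_ (merge S P) ≡ weight e _>ᵐ_ S ∙ weight e _>ᵇ_ P
    weight-merge {[]} [] [] = sym (identityˡ ε)
    weight-merge {(v , just x) ∷ S} (just out ∷ cl) over =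
      trans (cong₂ _∙_ (row-just v out cl over) (weight-merge cl over)) (sym (assoc _ _ _))
    weight-merge {(v , nothing) ∷ S} {(_ , b) ∷ P} (_ ∷ cl) ((refl , _) ∷ over) =
      trans (cong₂ _∙_ (row-letter v b cl over) (weight-merge cl over)) (interchange _ _ _ _)

    module _ {_≺_ : V → V → Set} (q : W)
      (tame : ∀ {u v w} → u ≺ v → v ≺ w → u ≺ w → e u w ≡ ε ⊎ (e u v ≡ q × e v w ≡ q))
      where

      open TwoLetters e {_≺_} q tame

      ∑ʷ-swap : ∀ {X Y L α β} → X ↭ a ∷ suc a ∷ Y → All Outside Y → AllPairs _≺_ L →
                Swapped α β → ∀ φ →
                ∑ʷ X L (summand isCommutativeMonoid e α φ) ≡
                ∑ʷ X L (summand isCommutativeMonoid e β φ)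
      ∑ʷ-swap {X} {Y} {L} {α} {β} X↭ out sorted swapped φ = begin
        ∑ʷ X L (term α)
          ≡⟨ ∑ʷ-skeleton X↭ L (term α) ⟩
        ∑ʷ Z L (λ S → ∑ᵇ (holes S) (term α ∘ merge S))
          ≡⟨ ∑ʷ-cong Z L (λ over → at-skeleton (clean out over) (holes-sorted sorted over)) ⟩
        ∑ʷ Z L (λ S → ∑ᵇ (holes S) (term β ∘ merge S))
          ≡⟨ ∑ʷ-skeleton X↭ L (term β) ⟨
        ∑ʷ X L (term β) ∎
        where
        Z = nothing ∷ map just Y

        term : Monomial → Word V ℕ → ℕ
        term γ = summand isCommutativeMonoid e γ φ

        -- For a fixed skeleton the summand varies only with the zeros, ones and weight of the
        -- two-letter word, so it is a `Stat`.
        stat : Monomial → Word V (Maybe ℕ) → Stat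
        stat γ S z o w =
          indicator (fillHoles (mapMaybe proj₂ S) z o ≈? γ) * φ (weight e _>ᵐ_ S ∙ w)

        term-merge : ∀ γ {S P} → Clean S → Over bits (holes S) P →
                        term γ (merge S P) ≡ stat γ S (zeros P) (ones P) (wt P)
        term-merge γ {S} {P} cl over = cong₂ _*_
          (indicator-cong (content (merge S P) ≈? γ)
            (fillHoles (mapMaybe proj₂ S) (zeros P) (ones P) ≈? γ)
            (λ eq k → trans (sym (content-merge S over k)) (eq k))
            (λ eq k → trans (content-merge S over k) (eq k)))
          (cong φ (weight-merge cl over))

        at-skeleton : ∀ {S} → Clean S → AllPairs _≺_ (holes S) →
          ∑ᵇ (holes S) (term α ∘ merge S) ≡ ∑ᵇ (holes S) (term β ∘ merge S)
        at-skeleton {S} cl sortedʰ = begin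
          ∑ᵇ (holes S) (term α ∘ merge S)
            ≡⟨ ∑ʷ-cong bits (holes S) (term-merge α cl) ⟩
          total (holes S) (stat α S)
            ≡⟨ total-symmetric _ (holes S) ≤-refl sortedʰ (stat α S) ⟩
          total (holes S) (λ z o → stat α S o z)
            -- Exchanging the numbers of zeros and ones turns the condition of having content `α`
            -- into that of having content `β`.
            ≡⟨ ∑ʷ-cong bits (holes S) (λ {P} _ → cong (_* φ (weight e _>ᵐ_ S ∙ wt P))
                 (indicator-cong
                   (fillHoles (mapMaybe proj₂ S) (ones P) (zeros P) ≈? α)
                   (fillHoles (mapMaybe proj₂ S) (zeros P) (ones P) ≈? β)
                   (fillHoles-swap (clean⇒outside cl) swapped (ones P) (zeros P))
                   (fillHoles-swap (clean⇒outside cl) (Swapped-sym swapped) (zeros P) (ones P)))) ⟩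
          total (holes S) (stat β S)
            ≡⟨ ∑ʷ-cong bits (holes S) (term-merge β cl) ⟨
          ∑ᵇ (holes S) (term β ∘ merge S) ∎

-- Fillings as words

∑-filter : ∀ {P : A → Set} (P? : ∀ x → Dec (P x)) xs (f : A → ℕ) →
           ∑ (filter P? xs) f ≡ ∑ xs λ x → indicator (P? x) * f x
∑-filter P? []       f = refl
∑-filter P? (x ∷ xs) f with P? x
... | yes _ = cong₂ _+_ (sym (+-identityʳ (f x))) (∑-filter P? xs f)
... | no  _ = ∑-filter P? xs f

length-filter-∑ : ∀ {P : A → Set} (P? : ∀ x → Dec (P x)) xs →
                  length (filter P? xs) ≡ ∑ xs λ x → indicator (P? x)
length-filter-∑ P? []       = refl
length-filter-∑ P? (x ∷ xs) with P? x
... | yes _ = cong suc (length-filter-∑ P? xs)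
... | no  _ = length-filter-∑ P? xs

∑-cartesianProductWith : ∀ {C : Set} (c : A → B → C) xs ys (f : C → ℕ) →
  ∑ (cartesianProductWith c xs ys) f ≡ ∑ xs λ x → ∑ ys λ y → f (c x y)
∑-cartesianProductWith c []       ys f = refl
∑-cartesianProductWith c (x ∷ xs) ys f =
  trans (∑-++ (map (c x) ys) _ f)
        (cong₂ _+_ (∑-map (c x) ys f) (∑-cartesianProductWith c xs ys f))

∑-*ʳ : ∀ (xs : List A) (f : A → ℕ) n → ∑ xs f * n ≡ ∑ xs λ x → f x * n
∑-*ʳ []       f n = refl
∑-*ʳ (x ∷ xs) f n = trans (*-distribʳ-+ n (f x) _) (cong (f x * n +_) (∑-*ʳ xs f n))

indicator-× : ∀ {P Q : Set} (P? : Dec P) (Q? : Dec Q) →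
              indicator (P? ×-dec Q?) ≡ indicator P? * indicator Q?
indicator-× (yes _) (yes _) = refl
indicator-× (yes _) (no  _) = refl
indicator-× (no  _) (yes _) = refl
indicator-× (no  _) (no  _) = refl

-- At most one summand is 1, because `P` has at most one solution and `xs` has no repetitions. It
-- serves to replace the existential in the definition of a descent by a sum over cells.
∑-indicator : ∀ {P : A → Set} (P? : ∀ x → Dec (P x)) → (∀ {x y} → P x → P y → x ≡ y) →
  ∀ {xs} → Unique xs → ∀ {Q : Set} (Q? : Dec Q) →
  (∀ {x} → P x → Q) → (Q → ∃ λ x → x ∈ xs × P x) →
  ∑ xs (λ x → indicator (P? x)) ≡ indicator Q?
∑-indicator P? P-unique {[]} [] Q? P⇒Q Q⇒P =
  sym (indicator-no Q? λ q → case-∈ (proj₁ (proj₂ (Q⇒P q))))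
  where
  case-∈ : ∀ {x} → x ∈ [] → ⊥
  case-∈ ()
∑-indicator P? P-unique {x ∷ xs} (x∉xs ∷ unique) Q? P⇒Q Q⇒P with P? x
... | yes px = trans (cong suc (trans (∑-cong xs λ {y} y∈xs →
                 indicator-no (P? y) λ py → All.lookup x∉xs y∈xs (P-unique px py)) (∑-zero xs)))
               (sym (indicator-yes Q? (P⇒Q px)))
... | no ¬px = ∑-indicator P? P-unique unique Q? P⇒Q λ q → shrink (Q⇒P q)
  where
  shrink : ∃ (λ y → y ∈ x ∷ xs × _) → ∃ λ y → y ∈ xs × _
  shrink (y , here refl  , py) = ⊥-elim (¬px py)
  shrink (y , there y∈xs , py) = y , y∈xs , py

-- `F` sees `f` only through its tabulated values, so the consing of functions turns into the
-- consing of words by computation.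
∑-functions : ∀ {n} (X : List A) (ι : Fin n → V) (F : Word V A → ℕ) →
  ∑ (functions {n} {λ _ → A} λ _ → X) (λ f → F (tabulate λ j → ι j , f j)) ≡
  ∑ʷ X (tabulate ι) F
∑-functions {n = zero}  X ι F = +-identityʳ (F [])
∑-functions {n = suc n} X ι F = trans
  (∑-cartesianProductWith _ X _ _)
  (∑-cong X λ {x} _ → ∑-functions X (ι ∘ suc) (F ∘ ((ι zero , x) ∷_)))

∑-functions₂ : ∀ {n} (m : Fin n → ℕ) (X : List A) (ι : ∀ i → Fin (m i) → V) (F : Word V A → ℕ) →
  ∑ (functions λ i → functions {m i} {λ _ → A} λ _ → X)
    (λ f → F (concat (tabulate λ i → tabulate λ j → ι i j , f i j))) ≡
  ∑ʷ X (concat (tabulate λ i → tabulate (ι i))) F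
∑-functions₂ {n = zero}  m X ι F = +-identityʳ (F [])
∑-functions₂ {A = A} {n = suc n} m X ι F = begin
  _
    ≡⟨ ∑-cartesianProductWith _ fs gs _ ⟩
  ∑ fs (λ f → ∑ gs λ g →
    F (tabulate (λ j → ι zero j , f j) ++ concat (tabulate λ i → tabulate λ j → ι (suc i) j , g i j)))
    ≡⟨ ∑-cong fs (λ {f} _ →
         ∑-functions₂ (m ∘ suc) X (ι ∘ suc) (F ∘ (tabulate (λ j → ι zero j , f j) ++_))) ⟩
  ∑ fs (λ f → ∑ʷ X rest λ Q → F (tabulate (λ j → ι zero j , f j) ++ Q))
    ≡⟨ ∑-functions X (ι zero) (λ P → ∑ʷ X rest λ Q → F (P ++ Q)) ⟩
  ∑ʷ X (tabulate (ι zero)) (λ P → ∑ʷ X rest λ Q → F (P ++ Q))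
    ≡⟨ ∑ʷ-++ X (tabulate (ι zero)) rest ⟨
  ∑ʷ X (tabulate (ι zero) ++ rest) F ∎
  where
  fs = functions {m zero} {λ _ → A} λ _ → X
  gs = functions λ i → functions {m (suc i)} {λ _ → A} λ _ → X
  rest = concat (tabulate λ i → tabulate (ι (suc i)))

∑ʷ-zero : ∀ (X : List A) (L : List V) → ∑ʷ X L (λ _ → 0) ≡ 0
∑ʷ-zero X []      = refl
∑ʷ-zero X (v ∷ L) = trans (∑-cong X λ _ → ∑ʷ-zero X L) (∑-zero X)

-- The letters from `M` upwards are removed from the alphabet one at a time, the largest first;
-- words that contain one contribute 0.
∑ʷ-bound : ∀ M d (L : List V) (F : Word V ℕ → ℕ) →
  (∀ {v x P} → M ≤ x → (v , x) ∈ P → F P ≡ 0) → ∑ʷ (upTo (d + M)) L F ≡ ∑ʷ (upTo M) L F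
∑ʷ-bound M zero    L F vanish = refl
∑ʷ-bound M (suc d) L F vanish = trans (drop-N L F vanish) (∑ʷ-bound M d L F vanish)
  where
  N = d + M

  drop-N : ∀ L F → (∀ {v x P} → M ≤ x → (v , x) ∈ P → F P ≡ 0) →
         ∑ʷ (upTo (suc N)) L F ≡ ∑ʷ (upTo N) L F
  drop-N []      F vanish = refl
  drop-N (v ∷ L) F vanish = begin
    ∑ (upTo (suc N)) G        ≡⟨ cong (λ xs → ∑ xs G) (upTo-∷ʳ N) ⟨
    ∑ (upTo N ++ N ∷ []) G    ≡⟨ ∑-++ (upTo N) (N ∷ []) G ⟩
    ∑ (upTo N) G + (G N + 0)  ≡⟨ cong (∑ (upTo N) G +_) (trans (+-identityʳ (G N)) G-N) ⟩
    ∑ (upTo N) G + 0          ≡⟨ +-identityʳ _ ⟩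
    ∑ (upTo N) G              ≡⟨ ∑-cong (upTo N) (λ _ → drop-N L _ λ M≤x ∈P → vanish M≤x (there ∈P)) ⟩
    ∑ʷ (upTo N) (v ∷ L) F     ∎
    where
    G : ℕ → ℕ
    G x = ∑ʷ (upTo (suc N)) L λ P → F ((v , x) ∷ P)

    G-N : G N ≡ 0
    G-N = trans (∑ʷ-cong _ L λ _ → vanish (m≤n+m M d) (here refl)) (∑ʷ-zero _ L)

-- Reading order

-- `cells` starts with the bottom row, whereas the reading order starts with the top row.
reading : ∀ {n} → (Fin n → List V) → List V
reading {n = zero}  rows = []
reading {n = suc n} rows = reading (rows ∘ suc) ++ rows zero

reading-↭ : ∀ {n} (rows : Fin n → List V) → concat (tabulate rows) ↭ reading rows
reading-↭ {n = zero}  rows = ↭.refl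
reading-↭ {n = suc n} rows =
  ↭.trans (↭.++-comm (rows zero) _) (↭.++⁺ʳ (rows zero) (reading-↭ (rows ∘ suc)))

∈-reading⁻ : ∀ {n} (rows : Fin n → List V) {u} → u ∈ reading rows → ∃ λ i → u ∈ rows i
∈-reading⁻ {n = suc n} rows u∈ with ∈.∈-++⁻ (reading (rows ∘ suc)) u∈
... | inj₂ u∈₀ = zero , u∈₀
... | inj₁ u∈′ with ∈-reading⁻ (rows ∘ suc) u∈′
...   | i , u∈ᵢ = suc i , u∈ᵢ

reading-sorted : ∀ {n} {_≺_ : V → V → Set} (rows : Fin n → List V) →
  (∀ i → AllPairs _≺_ (rows i)) →
  (∀ {i j u v} → toℕ i < toℕ j → u ∈ rows j → v ∈ rows i → u ≺ v) →
  AllPairs _≺_ (reading rows)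
reading-sorted {n = zero}  rows sorted down = []
reading-sorted {n = suc n} rows sorted down =
  AllPairs.++⁺ (reading-sorted (rows ∘ suc) (sorted ∘ suc) (down ∘ s<s)) (sorted zero)
    (All.tabulate λ u∈ → All.tabulate λ v∈ →
      down z<s (proj₂ (∈-reading⁻ (rows ∘ suc) u∈)) v∈)

Unique-resp-↭ : {xs ys : List A} → xs ↭ ys → Unique xs → Unique ys
Unique-resp-↭ xs↭ys = ↭ₛ.Unique-resp-↭ (setoid _) (↭⇒↭ₛ xs↭ys)

-- Used twice: to bring the two exchanged letters to the front of the alphabet, and to bring the
-- image of an initial segment under a permutation to the front of a longer segment.
extract : ∀ (ys : List A) {xs} → Unique xs → Unique ys → (∀ {x} → x ∈ ys → x ∈ xs) →
          ∃ λ zs → xs ↭ ys ++ zs × (∀ {x} → x ∈ zs → x ∉ ys)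
extract []       {xs} _     _             ⊆  = xs , ↭.refl , λ _ ()
extract (y ∷ ys) {xs} xs-un (y∉ys ∷ ys-un) ⊆ with ∈.∈-∃++ (⊆ (here refl))
... | us , vs , refl with Unique-resp-↭ (↭.shift y us vs) xs-un
... | y∉ws ∷ ws-un with extract ys ws-un ys-un (λ x∈ys →
        keep (All.lookup y∉ys x∈ys) (↭.∈-resp-↭ (↭.shift y us vs) (⊆ (there x∈ys))))
  where
  keep : ∀ {x ws} → y ≢ x → x ∈ y ∷ ws → x ∈ ws
  keep y≢x (here refl)  = ⊥-elim (y≢x refl)
  keep y≢x (there x∈ws) = x∈ws
... | zs , ws↭ , zs∌ = zs , ↭.trans (↭.shift y us vs) (prep y ws↭) , λ where
  x∈zs (here refl)  → All.lookup y∉ws (↭.∈-resp-↭ (↭-sym ws↭) (∈.∈-++⁺ʳ ys x∈zs)) refl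
  x∈zs (there x∈ys) → zs∌ x∈zs x∈ys

-- Products over all ordered pairs.

module _ {W : Set} {_∙_ : W → W → W} {ε : W}
  (isCommutativeMonoid : IsCommutativeMonoid _≡_ _∙_ ε) {V : Set} (e : V → V → W)
  {A : Set} (_≻_ : A → A → Bool)
  where

  open Weights isCommutativeMonoid {V}

  -- Unlike `weight`, this does not depend on the order of the entries, so it links the order of
  -- `cells` with the reading order.
  allPairsWeight : Word V A → W
  allPairsWeight P = ∏ P λ p → ∏ P (pairWeight e _≻_ p)

  allPairsWeight-↭ : ∀ {P Q} → P ↭ Q → allPairsWeight P ≡ allPairsWeight Q
  allPairsWeight-↭ {P} {Q} P↭Q =
    trans (∏-↭ P↭Q _) (∏-cong Q λ _ → ∏-↭ P↭Q _)

  -- Edges against the order of `L` are trivial and no letter exceeds itself, so only the pairs in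
  -- list order contribute.
  allPairsWeight≡weight : (∀ x → x ≻ x ≡ false) → ∀ {X L P} →
                          AllPairs (λ u v → e v u ≡ ε) L → Over X L P →
                          allPairsWeight P ≡ weight e _≻_ P
  allPairsWeight≡weight irrefl []             []                   = refl
  allPairsWeight≡weight irrefl {P = p@(u , x) ∷ P} (u≺L ∷ sorted) ((refl , _) ∷ over) = begin
    (pw p p ∙ ∏ P (pw p)) ∙ ∏ P (λ p′ → pw p′ p ∙ ∏ P (pw p′))
      ≡⟨ cong₂ _∙_ (trans (cong (λ b → (if b then e u u else ε) ∙ ∏ P (pw p)) (irrefl x))
                            (identityˡ _)) (∏-∙ P) ⟩
    ∏ P (pw p) ∙ (∏ P (λ p′ → pw p′ p) ∙ allPairsWeight P)
      ≡⟨ cong (∏ P (pw p) ∙_) (trans (cong (_∙ allPairsWeight P) (column-ε u≺L over)) (identityˡ _)) ⟩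
    ∏ P (pw p) ∙ allPairsWeight P
      ≡⟨ cong (∏ P (pw p) ∙_) (allPairsWeight≡weight irrefl sorted over) ⟩
    ∏ P (pw p) ∙ weight e _≻_ P ∎
    where
    pw = pairWeight e _≻_
    column-ε : ∀ {X L P} → All (λ v → e v u ≡ ε) L → Over X L P → ∏ P (λ p′ → pw p′ p) ≡ ε
    column-ε [] [] = refl
    column-ε {P = (v , y) ∷ P} (vu ∷ all) ((refl , _) ∷ over) =
      trans (cong₂ _∙_ if-ε (column-ε all over)) (identityˡ ε)
      where
      if-ε : (if y ≻ x then e v u else ε) ≡ ε
      if-ε with y ≻ x
      ... | true  = vu
      ... | false = refl

-- The weight of a filling

qt : Set
qt = ℤ × ℕ

_⊕_ : qt → qt → qt
(i , m) ⊕ (j , n) = i ℤ.+ j , m + n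

0ᵠᵗ : qt
0ᵠᵗ = ⁺ 0 , 0

⊕-isCommutativeMonoid : IsCommutativeMonoid _≡_ _⊕_ 0ᵠᵗ
⊕-isCommutativeMonoid = record
  { isMonoid = record
    { isSemigroup = record
      { isMagma = record { isEquivalence = isEquivalence ; ∙-cong = cong₂ _⊕_ }
      ; assoc   = λ (i , m) (j , n) (k , o) → cong₂ _,_ (ℤ.+-assoc i j k) (+-assoc m n o)
      }
    ; identity = (λ (i , m) → cong (_, m) (ℤ.+-identityˡ i))
               , (λ (i , m) → cong₂ _,_ (ℤ.+-identityʳ i) (+-identityʳ m))
    }
  ; comm = λ (i , m) (j , n) → cong₂ _,_ (ℤ.+-comm i j) (+-comm m n)
  }

module _ {V : Set} where

  open Weights ⊕-isCommutativeMonoid {V}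

  proj₁-∏ : ∀ (xs : List A) {f : A → qt} {m n : A → ℕ} →
            (∀ x → proj₁ (f x) ≡ ⁺ m x ℤ.- ⁺ n x) →
            proj₁ (∏ xs f) ≡ ⁺ ∑ xs m ℤ.- ⁺ ∑ xs n
  proj₁-∏ []       eq = refl
  proj₁-∏ (x ∷ xs) {f} {m} {n} eq =
    trans (cong₂ ℤ._+_ (eq x) (proj₁-∏ xs {f} {m} {n} eq))
      (trans (rearrange (⁺ m x) (⁺ n x) (⁺ ∑ xs m) (⁺ ∑ xs n))
        (cong₂ ℤ._-_ (sym (ℤ.pos-+ (m x) (∑ xs m))) (sym (ℤ.pos-+ (n x) (∑ xs n)))))
    where
    rearrange : ∀ i j k l → (i ℤ.- j) ℤ.+ (k ℤ.- l) ≡ (i ℤ.+ k) ℤ.- (j ℤ.+ l)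
    rearrange = solve-∀ᶻ

  proj₂-∏ : ∀ (xs : List A) {f : A → qt} {n : A → ℕ} →
            (∀ x → proj₂ (f x) ≡ n x) → proj₂ (∏ xs f) ≡ ∑ xs n
  proj₂-∏ []       eq = refl
  proj₂-∏ (x ∷ xs) {f} eq = cong₂ _+_ (eq x) (proj₂-∏ xs {f} eq)

proj₁-if : ∀ {P : Set} (P? : Dec P) m n k →
  proj₁ (if does P? then (⁺ m ℤ.- ⁺ n , k) else 0ᵠᵗ) ≡ ⁺ (indicator P? * m) ℤ.- ⁺ (indicator P? * n)
proj₁-if (yes _) m n k = cong₂ (λ m n → ⁺ m ℤ.- ⁺ n) (sym (+-identityʳ m)) (sym (+-identityʳ n))
proj₁-if (no  _) m n k = refl

proj₂-if : ∀ {P : Set} (P? : Dec P) i k →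
  proj₂ (if does P? then (i , k) else 0ᵠᵗ) ≡ indicator P? * k
proj₂-if (yes _) i k = sym (+-identityʳ k)
proj₂-if (no  _) i k = refl

module _ (μ : Partition) where

  open Weights ⊕-isCommutativeMonoid {Cell μ}

  inversionWeight? : ∀ u v → Dec (Attack μ u v × Precedes μ u v)
  inversionWeight? u v = attack? μ u v ×-dec precedes? μ u v

  edge : Cell μ → Cell μ → qt
  edge u v = (⁺ indicator (inversionWeight? u v) ℤ.- ⁺ (indicator (directlyAbove? μ u v) * arm μ u))
           , indicator (directlyAbove? μ u v) * (leg μ u + 1)

  attack⇒not-above : ∀ {u v} → Attack μ u v → DirectlyAbove μ u v → ⊥
  attack⇒not-above (inj₁ (row≡ , _))         (row-u , _) = 1+n≢n (trans (sym row-u) row≡)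
  attack⇒not-above (inj₂ (inj₁ (_ , col<)))  (_ , col≡)  = <⇒≢ col< (sym col≡)
  attack⇒not-above (inj₂ (inj₂ (row-v , _))) (row-u , _) =
    <⇒≢ (m<n⇒m<1+n (n<1+n _)) (trans row-v (cong suc row-u))

  edge-attack : ∀ {u v} → Attack μ u v → Precedes μ u v → edge u v ≡ (⁺ 1 , 0)
  edge-attack {u} {v} att pre
    rewrite indicator-yes (inversionWeight? u v) (att , pre)
          | indicator-no (directlyAbove? μ u v) (attack⇒not-above att) = refl

  edge-free : ∀ {u v} → ((Attack μ u v × Precedes μ u v) → ⊥) → (DirectlyAbove μ u v → ⊥) →
              edge u v ≡ 0ᵠᵗ
  edge-free {u} {v} ¬inv ¬above
    rewrite indicator-no (inversionWeight? u v) ¬inv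
          | indicator-no (directlyAbove? μ u v) ¬above = refl

  Precedes-asym : ∀ {u v} → Precedes μ u v → Precedes μ v u → ⊥
  Precedes-asym (inj₁ r)       (inj₁ r′)        = <-asym r r′
  Precedes-asym (inj₁ r)       (inj₂ (r′ , _))  = <⇒≢ r r′
  Precedes-asym (inj₂ (r , _)) (inj₁ r′)        = <⇒≢ r′ r
  Precedes-asym (inj₂ (_ , c)) (inj₂ (_ , c′))  = <-asym c c′

  Precedes-irrefl : ∀ {u v} → Precedes μ u v → u ≢ v
  Precedes-irrefl u≺v refl = Precedes-asym u≺v u≺v

  edge-backwards : ∀ {u v} → Precedes μ u v → edge v u ≡ 0ᵠᵗ
  edge-backwards {u} {v} u≺v = edge-free (λ (_ , v≺u) → Precedes-asym u≺v v≺u) (not-above u≺v)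
    where
    not-above : Precedes μ u v → DirectlyAbove μ v u → ⊥
    not-above (inj₁ r)       (row-v , _) = <⇒≱ r (≤-trans (n≤1+n _) (≤-reflexive (sym row-v)))
    not-above (inj₂ (r , _)) (row-v , _) = 1+n≢n (trans (sym row-v) (sym r))

  edge-same-row : ∀ {u v} → row μ u ≡ row μ v → col μ u < col μ v → edge u v ≡ (⁺ 1 , 0)
  edge-same-row r c = edge-attack (inj₁ (r , λ { refl → <-irrefl refl c })) (inj₂ (r , c))

  edge-upper-right : ∀ {u v} → row μ u ≡ suc (row μ v) → col μ v < col μ u → edge u v ≡ (⁺ 1 , 0)
  edge-upper-right r c = edge-attack (inj₂ (inj₁ (r , c))) (inj₁ (≤-reflexive (sym r)))

  -- In reading order, with rows padded to equal length n, the cells preceding w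
  -- that interact with it are at distance at most n, and all at distance < n
  -- attack it.
  edge-tame : ∀ {u v w} → Precedes μ u v → Precedes μ v w → Precedes μ u w →
              edge u w ≡ 0ᵠᵗ ⊎ (edge u v ≡ (⁺ 1 , 0) × edge v w ≡ (⁺ 1 , 0))
  edge-tame {u} {v} {w} u≺v v≺w (inj₂ (row-uw , _)) = inj₂ (same-row u≺v v≺w)
    where
    same-row : Precedes μ u v → Precedes μ v w → edge u v ≡ (⁺ 1 , 0) × edge v w ≡ (⁺ 1 , 0)
    same-row (inj₂ (r , c)) (inj₂ (r′ , c′)) = edge-same-row r c , edge-same-row r′ c′
    same-row (inj₁ r) (inj₁ r′)       = ⊥-elim (<⇒≢ (<-trans r′ r) (sym row-uw))
    same-row (inj₁ r) (inj₂ (r′ , _)) = ⊥-elim (<⇒≢ r (trans r′ (sym row-uw)))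
    same-row (inj₂ (r , _)) (inj₁ r′) = ⊥-elim (<⇒≢ r′ (trans (sym row-uw) r))
  edge-tame {u} {v} {w} u≺v v≺w (inj₁ row-w<u) =
    -- For `u` in a higher row than `w`, only this position allows a nontrivial edge: a strict
    -- inequality of columns is an attack, and equality puts `u` directly above `w`.
    interaction ((row μ u ≟ suc (row μ w)) ×-dec (col μ w ≤? col μ u))
    where
    between : row μ u ≡ suc (row μ w) → col μ w ≤ col μ u → Precedes μ u v → Precedes μ v w →
              edge u v ≡ (⁺ 1 , 0) × edge v w ≡ (⁺ 1 , 0)
    between row-u _     (inj₁ r) (inj₁ r′) =
      ⊥-elim (<⇒≱ r (≤-trans (≤-reflexive row-u) r′))
    between row-u col≤ (inj₁ r) (inj₂ (r′ , c′)) =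
      edge-upper-right (trans row-u (cong suc (sym r′))) (<-≤-trans c′ col≤) , edge-same-row r′ c′
    between row-u col≤ (inj₂ (r , c)) _ =
      edge-same-row r c , edge-upper-right (trans (sym r) row-u) (≤-<-trans col≤ c)

    interaction : Dec (row μ u ≡ suc (row μ w) × col μ w ≤ col μ u) →
                  edge u w ≡ 0ᵠᵗ ⊎ (edge u v ≡ (⁺ 1 , 0) × edge v w ≡ (⁺ 1 , 0))
    interaction (yes (row-u , col≤)) = inj₂ (between row-u col≤ u≺v v≺w)
    interaction (no ¬close)          = inj₁ (edge-free
      (λ { (inj₁ (r , _) , _)        → <⇒≢ row-w<u (sym r)
         ; (inj₂ (inj₁ (r , c)) , _) → ¬close (r , <⇒≤ c)
         ; (inj₂ (inj₂ (r , _)) , _) → <⇒≱ row-w<u (≤-trans (n≤1+n _) (≤-reflexive (sym r))) })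
      (λ (r , c) → ¬close (r , ≤-reflexive (sym c))))

  rowCells : Fin (length (parts μ)) → List (Cell μ)
  rowCells i = tabulate (i ,_)

  cells≡ : cells μ ≡ concat (tabulate rowCells)
  cells≡ = cong concat (trans (map-tabulate id _) (tabulate-cong λ i → map-tabulate id (i ,_)))

  graph : Filling μ → Word (Cell μ) ℕ
  graph σ = map (λ u → u , σ u) (cells μ)

  graph≡ : ∀ σ → graph σ ≡ concat (tabulate λ i → tabulate λ j → (i , j) , σ (i , j))
  graph≡ σ = begin
    map pairσ (cells μ)                                    ≡⟨ cong (map pairσ) cells≡ ⟩
    map pairσ (concat (tabulate rowCells))                 ≡⟨ concat-map (tabulate rowCells) ⟨
    concat (map (map pairσ) (tabulate rowCells))
      ≡⟨ cong concat (map-tabulate rowCells (map pairσ)) ⟩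
    concat (tabulate (map pairσ ∘ rowCells))
      ≡⟨ cong concat (tabulate-cong λ i → map-tabulate (i ,_) pairσ) ⟩
    concat (tabulate λ i → tabulate λ j → (i , j) , σ (i , j)) ∎
    where
    pairσ : Cell μ → Cell μ × ℕ
    pairσ u = u , σ u

  readingOrder : List (Cell μ)
  readingOrder = reading rowCells

  cells-↭ : cells μ ↭ readingOrder
  cells-↭ = subst (_↭ readingOrder) (sym cells≡) (reading-↭ rowCells)

  readingOrder-sorted : AllPairs (Precedes μ) readingOrder
  readingOrder-sorted = reading-sorted rowCells
    (λ i → AllPairs.tabulate⁺-< λ j<k → inj₂ (refl , j<k)) down
    where
    down : ∀ {i j u v} → toℕ i < toℕ j → u ∈ rowCells j → v ∈ rowCells i → Precedes μ u v
    down i<j u∈ v∈ with ∈.∈-tabulate⁻ u∈ | ∈.∈-tabulate⁻ v∈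
    ... | _ , refl | _ , refl = inj₁ i<j

  cells-unique : Unique (cells μ)
  cells-unique = Unique-resp-↭ (↭-sym cells-↭) (AllPairs.map Precedes-irrefl readingOrder-sorted)

  ∈-cells : ∀ u → u ∈ cells μ
  ∈-cells (i , j) = subst ((i , j) ∈_) (sym cells≡)
    (∈.∈-concat⁺′ (∈.∈-tabulate⁺ j) (∈.∈-tabulate⁺ i))

  below-unique : ∀ {u v w} → DirectlyAbove μ u v → DirectlyAbove μ u w → v ≡ w
  below-unique {v = i , j} {k , l} (r , c) (r′ , c′)
    with Fin.toℕ-injective (suc-injective (trans (sym r) r′))
  ... | refl = cong (i ,_) (Fin.toℕ-injective (trans (sym c) c′))

  module _ (σ : Filling μ) where

    g? : ∀ u v → Dec (σ v < σ u)
    g? u v = σ v <? σ u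

    -- There is at most one cell below `u`, so the indicator of a descent at `u` is a sum over all
    -- `v` with at most one nonzero term.
    descents : ∀ (f : Cell μ → ℕ) →
      sum (map f (Des μ σ)) ≡
      ∑ (cells μ) λ u → ∑ (cells μ) λ v → indicator (g? u v) * (indicator (directlyAbove? μ u v) * f u)
    descents f = trans (∑-filter (isDescent? μ σ) (cells μ) f) (∑-cong (cells μ) λ {u} _ → begin
      indicator (isDescent? μ σ u) * f u
        ≡⟨ cong (_* f u) (∑-indicator (λ v → directlyAbove? μ u v ×-dec g? u v)
             (λ (above , _) (above′ , _) → below-unique above above′)
             cells-unique (isDescent? μ σ u) (λ {v} p → v , p) (λ (v , p) → v , ∈-cells v , p)) ⟨
      ∑ (cells μ) (λ v → indicator (directlyAbove? μ u v ×-dec g? u v)) * f u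
        ≡⟨ ∑-*ʳ (cells μ) _ (f u) ⟩
      ∑ (cells μ) (λ v → indicator (directlyAbove? μ u v ×-dec g? u v) * f u)
        ≡⟨ ∑-cong (cells μ) (λ {v} _ → trans
             (cong (_* f u) (trans (indicator-× (directlyAbove? μ u v) (g? u v))
                                   (*-comm (indicator (directlyAbove? μ u v)) _)))
             (*-assoc (indicator (g? u v)) _ _)) ⟩
      ∑ (cells μ) (λ v → indicator (g? u v) * (indicator (directlyAbove? μ u v) * f u)) ∎)

    inversions : length (Inv μ σ) ≡
      ∑ (cells μ) λ u → ∑ (cells μ) λ v → indicator (g? u v) * indicator (inversionWeight? u v)
    inversions = begin
      length (Inv μ σ)
        ≡⟨ length-filter-∑ (isInversion? μ σ) (cartesianProduct (cells μ) (cells μ)) ⟩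
      ∑ (cartesianProduct (cells μ) (cells μ)) (λ p → indicator (isInversion? μ σ p))
        ≡⟨ ∑-cartesianProductWith _,_ (cells μ) (cells μ) (λ p → indicator (isInversion? μ σ p)) ⟩
      ∑ (cells μ) (λ u → ∑ (cells μ) λ v → indicator (isInversion? μ σ (u , v)))
        ≡⟨ ∑-cong (cells μ) (λ {u} _ → ∑-cong (cells μ) λ {v} _ → trans
             (indicator-cong (isInversion? μ σ (u , v)) (g? u v ×-dec inversionWeight? u v)
               (λ (a , p , g) → g , a , p) (λ (g , a , p) → a , p , g))
             (indicator-× (g? u v) (inversionWeight? u v))) ⟩
      ∑ (cells μ) (λ u → ∑ (cells μ) λ v → indicator (g? u v) * indicator (inversionWeight? u v)) ∎

    -- Both statistics are sums over ordered pairs of cells in which the indicator of `σ u > σ v`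
    -- factors out; what remains are the two components of `edge u v`.
    statistics : (inv μ σ , maj μ σ) ≡
                 allPairsWeight ⊕-isCommutativeMonoid edge _>ᴺ_ (graph σ)
    statistics = sym (begin
      allPairsWeight ⊕-isCommutativeMonoid edge _>ᴺ_ (graph σ)
        ≡⟨ ∏-map pairσ (cells μ) (λ p → ∏ (graph σ) (pairWeight edge _>ᴺ_ p)) ⟩
      ∏ (cells μ) (λ u → ∏ (graph σ) (pairWeight edge _>ᴺ_ (pairσ u)))
        ≡⟨ ∏-cong (cells μ) (λ {u} _ → ∏-map pairσ (cells μ) (pairWeight edge _>ᴺ_ (pairσ u))) ⟩
      ∏ (cells μ) (λ u → ∏ (cells μ) (ifEdge u))
        ≡⟨ cong₂ _,_ inv≡ maj≡ ⟩
      (inv μ σ , maj μ σ) ∎)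
      where
      pairσ : Cell μ → Cell μ × ℕ
      pairσ u = u , σ u

      ifEdge : Cell μ → Cell μ → qt
      ifEdge u v = if does (g? u v) then edge u v else 0ᵠᵗ

      inv≡ : proj₁ (∏ (cells μ) λ u → ∏ (cells μ) (ifEdge u)) ≡ inv μ σ
      inv≡ = trans
        (proj₁-∏ {V = Cell μ} (cells μ) {f = λ u → ∏ (cells μ) (ifEdge u)} λ u →
          proj₁-∏ {V = Cell μ} (cells μ) {f = ifEdge u} λ v → proj₁-if (g? u v)
            (indicator (inversionWeight? u v)) (indicator (directlyAbove? μ u v) * arm μ u)
            (indicator (directlyAbove? μ u v) * (leg μ u + 1)))
        (cong₂ (λ m n → ⁺ m ℤ.- ⁺ n) (sym inversions) (sym (descents (arm μ))))

      maj≡ : proj₂ (∏ (cells μ) λ u → ∏ (cells μ) (ifEdge u)) ≡ maj μ σ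
      maj≡ = trans
        (proj₂-∏ {V = Cell μ} (cells μ) {f = λ u → ∏ (cells μ) (ifEdge u)} λ u →
          proj₂-∏ {V = Cell μ} (cells μ) {f = ifEdge u} λ v → proj₂-if (g? u v)
            (proj₁ (edge u v)) (indicator (directlyAbove? μ u v) * (leg μ u + 1)))
        (sym (descents λ u → leg μ u + 1))

  -- The coefficients of the series as sums over words.

  coefficient : ℤ → ℕ → qt → ℕ
  coefficient a b (i , m) = (q^ i t^ m) a b

  term : Monomial → ℤ → ℕ → Word (Cell μ) ℕ → ℕ
  term α a b = summand ⊕-isCommutativeMonoid edge α (coefficient a b)

  C≡∑ʷ-cells : ∀ α a b → C μ α a b ≡ ∑ʷ (upTo (bound α)) (cells μ) λ P →
    indicator (content P ≈? α) *
    coefficient a b (allPairsWeight ⊕-isCommutativeMonoid edge _>ᴺ_ P)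
  C≡∑ʷ-cells α a b = begin
    ∑ (map (λ σ → q^ inv μ σ t^ maj μ σ) (filter (λ σ → (x^_ μ σ) ≈? α) fillings)) (λ p → p a b)
      ≡⟨ ∑-map _ (filter (λ σ → (x^_ μ σ) ≈? α) fillings) (λ p → p a b) ⟩
    ∑ (filter (λ σ → (x^_ μ σ) ≈? α) fillings) (λ σ → coefficient a b (inv μ σ , maj μ σ))
      ≡⟨ ∑-filter (λ σ → (x^_ μ σ) ≈? α) fillings _ ⟩
    ∑ fillings (λ σ → indicator ((x^_ μ σ) ≈? α) * coefficient a b (inv μ σ , maj μ σ))
      ≡⟨ ∑-cong fillings (λ {σ} _ → cong₂ _*_
           (cong (λ γ → indicator (γ ≈? α)) (x^≡content σ))
           (cong (coefficient a b) (statistics σ))) ⟩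
    ∑ fillings (F ∘ graph)
      ≡⟨ ∑-map uncurry fs (F ∘ graph) ⟩
    ∑ fs (λ f → F (graph (uncurry f)))
      ≡⟨ ∑-cong fs (λ {f} _ → cong F (graph≡ (uncurry f))) ⟩
    ∑ fs (λ f → F (concat (tabulate λ i → tabulate λ j → (i , j) , f i j)))
      ≡⟨ ∑-functions₂ (lookup (parts μ)) (upTo (bound α)) _,_ F ⟩
    ∑ʷ (upTo (bound α)) (concat (tabulate rowCells)) F
      ≡⟨ cong (λ L → ∑ʷ (upTo (bound α)) L F) cells≡ ⟨
    ∑ʷ (upTo (bound α)) (cells μ) F ∎
    where
    fs = functions λ i → functions λ j → upTo (bound α)
    fillings = fillingsBelow μ (bound α)

    F : Word (Cell μ) ℕ → ℕ
    F P = indicator (content P ≈? α) *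
          coefficient a b (allPairsWeight ⊕-isCommutativeMonoid edge _>ᴺ_ P)

    x^≡content : ∀ σ → x^_ μ σ ≡ content (graph σ)
    x^≡content σ = cong (foldr _·_ 1ᴹ) (trans (map-∘ (cells μ)) (cong (map var) (map-∘ (cells μ))))

  content-↭ : ∀ {P Q : Word (Cell μ) ℕ} → P ↭ Q → content P ≈ content Q
  content-↭ {P} {Q} P↭Q k = begin
    exponent (content P) k                       ≡⟨ exponent-monomial (map proj₂ P) k ⟩
    ∑ (map proj₂ P) (λ x → indicator (x ≟ k))    ≡⟨ ∑-↭ (↭.map⁺ proj₂ P↭Q) _ ⟩
    ∑ (map proj₂ Q) (λ x → indicator (x ≟ k))    ≡⟨ exponent-monomial (map proj₂ Q) k ⟨
    exponent (content Q) k                       ∎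

  -- The content and `allPairsWeight` are invariant under permutation, so the cells may be put in
  -- reading order; there all backward edges are trivial and `weight` takes over.
  C≡∑ʷ : ∀ α a b → C μ α a b ≡ ∑ʷ (upTo (bound α)) readingOrder (term α a b)
  C≡∑ʷ α a b = trans (C≡∑ʷ-cells α a b) (trans
    (∑ʷ-↭ (upTo (bound α)) cells-↭ _ λ {P} {Q} P↭Q → cong₂ _*_
      (indicator-cong (content P ≈? α) (content Q ≈? α)
        (λ eq k → trans (sym (content-↭ P↭Q k)) (eq k))
        (λ eq k → trans (content-↭ P↭Q k) (eq k)))
      (cong (coefficient a b) (allPairsWeight-↭ ⊕-isCommutativeMonoid edge _>ᴺ_ P↭Q)))
    (∑ʷ-cong (upTo (bound α)) readingOrder λ {P} over →
      cong (λ w → indicator (content P ≈? α) * coefficient a b w)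
        (allPairsWeight≡weight ⊕-isCommutativeMonoid edge _>ᴺ_ >ᴺ-irrefl
          (AllPairs.map edge-backwards readingOrder-sorted) over)))

  content-vanish : ∀ {α} {v : Cell μ} {x P} → bound α ≤ x → (v , x) ∈ P → content P ≈ α → ⊥
  content-vanish {α} {x = x} {P} α≤x ∈P eq =
    <⇒≢ (positive-exponent P ∈P) (sym (trans (eq x) (vanishes α α≤x)))
    where
    positive-exponent : ∀ {v : Cell μ} P → (v , x) ∈ P → 0 < exponent (content P) x
    positive-exponent (_ ∷ P) (here refl) =
      ≤-trans (≤-reflexive (sym (indicator-yes (x ≟ x) refl))) (m≤m+n _ _)
    positive-exponent (_ ∷ P) (there ∈P)  = ≤-trans (positive-exponent P ∈P) (m≤n+m _ _)

  -- The enumeration in `C` depends on the witness `bound α`. A common larger alphabet makes the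
  -- coefficients of different monomials comparable; a letter from `bound α` upwards would have a
  -- positive exponent where that of `α` is 0.
  C≡∑ʷ-below : ∀ N α a b → bound α ≤ N → C μ α a b ≡ ∑ʷ (upTo N) readingOrder (term α a b)
  C≡∑ʷ-below N α a b α≤N = trans (C≡∑ʷ α a b) (trans
    (sym (∑ʷ-bound (bound α) (N ∸ bound α) readingOrder (term α a b) λ {_} {_} {P} α≤x ∈P →
      cong (_* coefficient a b (weight edge _>ᴺ_ P))
        (indicator-no (content P ≈? α) (content-vanish {α} {P = P} α≤x ∈P))))
    (cong (λ n → ∑ʷ (upTo n) readingOrder (term α a b)) (m∸n+n≡m α≤N)))

  C-cong : ∀ {α β} → α ≈ β → ∀ a b → C μ α a b ≡ C μ β a b
  C-cong {α} {β} α≈β a b = begin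
    C μ α a b
      ≡⟨ C≡∑ʷ-below N α a b (m≤m⊔n (bound α) (bound β)) ⟩
    ∑ʷ (upTo N) readingOrder (term α a b)
      ≡⟨ ∑ʷ-cong (upTo N) readingOrder (λ {P} _ → cong (_* coefficient a b (weight edge _>ᴺ_ P))
           (indicator-cong (content P ≈? α) (content P ≈? β)
             (λ eq k → trans (eq k) (α≈β k)) (λ eq k → trans (eq k) (sym (α≈β k))))) ⟩
    ∑ʷ (upTo N) readingOrder (term β a b)
      ≡⟨ C≡∑ʷ-below N β a b (m≤n⊔m (bound α) (bound β)) ⟨
    C μ β a b ∎
    where N = bound α ⊔ bound β

  C-swap : ∀ i {α β} → Skeleton.Swapped i α β → ∀ a b → C μ α a b ≡ C μ β a b
  C-swap i {α} {β} swapped a b = begin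
    C μ α a b
      ≡⟨ C≡∑ʷ-below N α a b (≤-trans (m≤m⊔n (bound α) (bound β)) (m≤m⊔n _ (2 + i))) ⟩
    ∑ʷ (upTo N) readingOrder (term α a b)
      ≡⟨ Skeleton.∑ʷ-swap i ⊕-isCommutativeMonoid edge (⁺ 1 , 0) edge-tame
           upTo↭ (All.tabulate λ x∈ → (λ { refl → rest∉ x∈ (here refl) })
                                     , (λ { refl → rest∉ x∈ (there (here refl)) }))
           readingOrder-sorted swapped (coefficient a b) ⟩
    ∑ʷ (upTo N) readingOrder (term β a b)
      ≡⟨ C≡∑ʷ-below N β a b (≤-trans (m≤n⊔m (bound α) (bound β)) (m≤m⊔n _ (2 + i))) ⟨
    C μ β a b ∎
    where
    -- The last term ensures that `i` and `suc i` both belong to `upTo N`.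
    N = bound α ⊔ bound β ⊔ (2 + i)

    extracted = extract (i ∷ suc i ∷ []) (upTo⁺ N) (((λ ()) ∷ []) ∷ [] ∷ []) λ
      { (here refl)         → ∈.∈-upTo⁺ (≤-trans (n≤1+n _) (m≤n⊔m (bound α ⊔ bound β) (2 + i)))
      ; (there (here refl)) → ∈.∈-upTo⁺ (m≤n⊔m (bound α ⊔ bound β) (2 + i)) }
    upTo↭ = proj₁ (proj₂ extracted)
    rest∉ = proj₂ (proj₂ extracted)

-- From adjacent transpositions to arbitrary permutations of the variables.

nth : List ℕ → ℕ → ℕ
nth []       k       = 0
nth (x ∷ xs) zero    = x
nth (x ∷ xs) (suc k) = nth xs k

nth-vanishes : ∀ xs {k} → length xs ≤ k → nth xs k ≡ 0
nth-vanishes []       _         = refl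
nth-vanishes (x ∷ xs) (s≤s ≤k) = nth-vanishes xs ≤k

fromExponents : List ℕ → Monomial
fromExponents xs = record { exponent = nth xs ; bound = length xs ; vanishes = nth-vanishes xs }

nth-swap : ∀ ws x y xs → Skeleton.Swapped (length ws)
           (fromExponents (ws ++ x ∷ y ∷ xs)) (fromExponents (ws ++ y ∷ x ∷ xs))
nth-swap [] x y xs = record { at-a = refl ; at-1+a = refl ; outside = outside }
  where
  outside : ∀ k → k ≢ 0 × k ≢ 1 → nth (y ∷ x ∷ xs) k ≡ nth (x ∷ y ∷ xs) k
  outside 0             (≢0 , _) = ⊥-elim (≢0 refl)
  outside 1             (_ , ≢1) = ⊥-elim (≢1 refl)
  outside (suc (suc k)) _        = refl
nth-swap (w ∷ ws) x y xs = record { at-a = at-a ; at-1+a = at-1+a ; outside = outside′ }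
  where
  open Skeleton.Swapped (nth-swap ws x y xs)
  outside′ : ∀ k → k ≢ suc (length ws) × k ≢ suc (suc (length ws)) →
             nth (w ∷ ws ++ y ∷ x ∷ xs) k ≡ nth (w ∷ ws ++ x ∷ y ∷ xs) k
  outside′ zero    _       = refl
  outside′ (suc k) (≢ , ≢′) = outside k (≢ ∘ cong suc , ≢′ ∘ cong suc)

-- A permutation of lists is built from exchanges of neighbours, each of which is a case of
-- `C-swap`. The prefix `ws` collects the entries already passed, and its length is the index of the
-- exchanged variable.
C-↭ : ∀ μ ws {xs ys} → xs ↭ ys → ∀ a b →
      C μ (fromExponents (ws ++ xs)) a b ≡ C μ (fromExponents (ws ++ ys)) a b
C-↭ μ ws ↭.refl          a b = refl
C-↭ μ ws {x ∷ xs} {x ∷ ys} (prep x xs↭ys) a b =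
  subst₂ (λ l r → C μ (fromExponents l) a b ≡ C μ (fromExponents r) a b)
    (++-assoc ws (x ∷ []) xs) (++-assoc ws (x ∷ []) ys) (C-↭ μ (ws ++ x ∷ []) xs↭ys a b)
C-↭ μ ws {x ∷ y ∷ xs} {y ∷ x ∷ ys} (swap x y xs↭ys) a b = trans
  (C-swap μ (length ws) (nth-swap ws x y xs) a b)
  (subst₂ (λ l r → C μ (fromExponents l) a b ≡ C μ (fromExponents r) a b)
    (++-assoc ws (y ∷ x ∷ []) xs) (++-assoc ws (y ∷ x ∷ []) ys)
    (C-↭ μ (ws ++ y ∷ x ∷ []) xs↭ys a b))
C-↭ μ ws (↭.trans p q)   a b = trans (C-↭ μ ws p a b) (C-↭ μ ws q a b)

nth-applyUpTo : ∀ (f : ℕ → ℕ) n zs → (∀ {k} → n ≤ k → f k ≡ 0) → All (_≡ 0) zs →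
                ∀ k → nth (applyUpTo f n ++ zs) k ≡ f k
nth-applyUpTo f zero    zs vanish all k = trans (nth-zeros zs all k) (sym (vanish z≤n))
  where
  nth-zeros : ∀ zs → All (_≡ 0) zs → ∀ k → nth zs k ≡ 0
  nth-zeros []       []          k       = refl
  nth-zeros (z ∷ zs) (z≡0 ∷ all) zero    = z≡0
  nth-zeros (z ∷ zs) (z≡0 ∷ all) (suc k) = nth-zeros zs all k
nth-applyUpTo f (suc n) zs vanish all zero    = refl
nth-applyUpTo f (suc n) zs vanish all (suc k) = nth-applyUpTo (f ∘ suc) n zs (vanish ∘ s≤s) all k

applyUpTo-bound : ∀ (f : ℕ → ℕ) n → ∃ λ N → ∀ {k} → k < n → f k < N
applyUpTo-bound f zero = 0 , λ ()
applyUpTo-bound f (suc n) with applyUpTo-bound f n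
... | N , below = N ⊔ suc (f n) , bounded
  where
  bounded : ∀ {k} → k < suc n → f k < N ⊔ suc (f n)
  bounded {k} k<1+n with k ≟ n
  ... | yes refl = m≤n⊔m N (suc (f n))
  ... | no  k≢n  = ≤-trans (below (≤∧≢⇒< (s≤s⁻¹ k<1+n) k≢n)) (m≤m⊔n N (suc (f n)))

theorem3p1 : (μ : Partition) → Symmetric (C μ)
theorem3p1 μ π α β α≡βπ a b = begin
  C μ α a b
    ≡⟨ C-cong μ (λ k → sym (nth-applyUpTo (exponent α) n zeros′ (vanishes α) zeros-≡0 k)) a b ⟩
  C μ (fromExponents (applyUpTo (exponent α) n ++ zeros′)) a b
    ≡⟨ C-↭ μ [] (↭-sym β↭α) a b ⟩
  C μ (fromExponents (applyUpTo (exponent β) N)) a b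
    ≡⟨ C-cong μ β≈ a b ⟩
  C μ β a b ∎
  where
  open Bijection π using (to; injective; strictlySurjective)
  n = bound α
  N₀ = proj₁ (applyUpTo-bound to n)
  -- `π` may move infinitely many indices, but finite segments suffice: below `N` lie the support of
  -- `β` and the images of all indices below `n`.
  N = bound β ⊔ N₀

  image : List ℕ
  image = map to (upTo n)

  image⊆ : ∀ {k} → k ∈ image → k ∈ upTo N
  image⊆ k∈ with ∈.∈-map⁻ to k∈
  ... | j , j∈ , refl =
    ∈.∈-upTo⁺ (≤-trans (proj₂ (applyUpTo-bound to n) (∈.∈-upTo⁻ j∈)) (m≤n⊔m (bound β) N₀))

  extracted = extract image (upTo⁺ N) (Unique-map⁺ injective (upTo⁺ n)) image⊆
  rest = proj₁ extracted

  zeros′ : List ℕ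
  zeros′ = map (exponent β) rest

  -- An index outside the image is `to j` for some `j` not below `bound α`, so the exponent of `β`
  -- there is that of `α` at `j`, namely 0.
  rest-≡0 : ∀ {k} → k ∈ rest → exponent β k ≡ 0
  rest-≡0 {k} k∈rest with strictlySurjective k
  ... | j , refl with j <? n
  ...   | yes j<n = ⊥-elim (proj₂ (proj₂ extracted) k∈rest (∈.∈-map⁺ to (∈.∈-upTo⁺ j<n)))
  ...   | no  j≮n = trans (α≡βπ j) (vanishes α (≮⇒≥ j≮n))

  zeros-≡0 : All (_≡ 0) zeros′
  zeros-≡0 = All.map⁺ (All.tabulate rest-≡0)

  -- Listing the indices below `N` with the image first, the exponents of `β` become those of `α`
  -- below `n`, followed by zeros.
  β↭α : applyUpTo (exponent β) N ↭ applyUpTo (exponent α) n ++ zeros′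
  β↭α = subst₂ _↭_ (map-upTo (exponent β) N)
    (trans (map-++ (exponent β) image rest) (cong (_++ zeros′)
      (trans (sym (map-∘ (upTo n))) (trans (map-cong α≡βπ (upTo n)) (map-upTo (exponent α) n)))))
    (↭.map⁺ (exponent β) (proj₁ (proj₂ extracted)))

  β≈ : fromExponents (applyUpTo (exponent β) N) ≈ β
  β≈ k = trans (cong (λ xs → nth xs k) (sym (++-identityʳ (applyUpTo (exponent β) N))))
    (nth-applyUpTo (exponent β) N [] (vanishes β ∘ ≤-trans (m≤m⊔n (bound β) N₀)) [] k)
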